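{- Let $q$ be a prime power and $r$ an even positive integer. Let $\{\alpha_1,\ldots,\alpha_r\}$ be a basis of $\mathbb{F}_{q^r}$ over $\mathbb{F}_q$ such that $\{\alpha_1,\ldots,\alpha_{r/2}\}$ is a basis of $\mathbb{F}_{q^{r/2}}$ over $\mathbb{F}_q$. Let $c_1,\ldots,c_r\in\mathbb{F}_q$, let $\mathcal{A}_i=\mathbb{F}_q\setminus\{c_i\}$ for $1\le i\le r$, and let $$\mathcal{G}_{\mathcal{A}}=\left\{\sum_{i=1}^r a_i\alpha_i:\ a_i\in\mathcal{A}_i \text{ for each } i\right\}.$$ Let $N(\mathcal{G}_{\mathcal{A}})$ denote the number of primitive elements of $\mathbb{F}_{q^r}$ lying in $\mathcal{G}_{\mathcal{A}}$. Then $$N(\mathcal{G}_{\mathcal{A}})>\frac{\phi(q^r-1)(q-1)^{3r/4}}{q^r-1}\left((q-1)^{1/4}-2q^{1/8}W(q^r-1)\right),$$ where $\phi$ is Euler's totient function and $W(q^r-1)$ is the number of square-free divisors of $q^r-1$.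
   Context: A primitive element of $\mathbb{F}_{q^r}$ is a generator of the cyclic group $\mathbb{F}_{q^r}^*$. -}

module Defs where

open import Level using (0ℓ)
open import Data.Nat using (ℕ; zero; suc)
import Data.Nat as N
open import Data.Nat.Divisibility using (_∣_; _∣?_)
open import Data.Nat.GCD using (gcd)
open import Data.Nat.Primality using (Prime)
open import Data.Fin using (Fin; toℕ; fromℕ<)
import Data.Fin as F
open import Data.List using (List; length; filter; upTo; map)
open import Data.List.Relation.Unary.All using (all?)
open import Data.Product using (Σ; ∃; _×_; _,_)
open import Relation.Nullary using (¬_; Dec; yes; no)
open import Relation.Nullary.Decidable using (¬?; _×-dec_)
open import Relation.Binary.PropositionalEquality using (_≡_)
open import Algebra.Bundles using (CommutativeRing)

module NumberTheory where
 open import Data.Nat using (_+_; _*_; _^_; _≤_; _<_; _≟_)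

 IsPrimePower : ℕ → Set
 IsPrimePower q = Σ ℕ λ p → Σ ℕ λ k → Prime p × 1 ≤ k × q ≡ p ^ k

 oneTo : ℕ → List ℕ
 oneTo n = map suc (upTo n)

 φ : ℕ → ℕ
 φ n = length (filter (λ k → gcd k n ≟ 1) (oneTo n))

 -- d is square-free: no m ≥ 2 with m² ∣ d  (decidable by bounded search; m ≤ d suffices when d ≥ 1)
 squarefree? : (d : ℕ) → Dec (Data.List.Relation.Unary.All.All (λ m → ¬ (m * m ∣ d)) (map (_+ 2) (upTo d)))
 squarefree? d = all? (λ m → ¬? (m * m ∣? d)) (map (_+ 2) (upTo d))

 W : ℕ → ℕ
 W n = length (filter (λ d → (d ∣? n) ×-dec squarefree? d) (oneTo n))

 -- `Root8Gt L u v` encodes the real-number inequality  L + u^(1/8) > v^(1/8)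
 -- (L, u, v natural numbers) exactly, without real numbers: it holds iff there is a
 -- nonnegative rational t = m/d (d ≥ 1) with t ≤ u^(1/8) (i.e. t^8 ≤ u) and L + t > v^(1/8)
 -- (i.e. (L + t)^8 > v).
 Root8Gt : ℕ → ℕ → ℕ → Set
 Root8Gt L u v = Σ ℕ λ m → Σ ℕ λ d →
   1 ≤ d × m ^ 8 ≤ u * d ^ 8 × v * d ^ 8 < (L * d + m) ^ 8

open NumberTheory public

record FiniteField : Set₁ where
  field
    ring : CommutativeRing 0ℓ 0ℓ
  open CommutativeRing ring public using (Carrier; _≈_)
  open CommutativeRing ring using (_*_; 0#; 1#)
  field
    1≉0       : ¬ (1# ≈ 0#)
    inverse   : ∀ x → ¬ (x ≈ 0#) → Σ Carrier λ y → x * y ≈ 1#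
    size      : ℕ
    enum      : Fin size → Carrier
    enum-surj : ∀ x → Σ (Fin size) λ i → enum i ≈ x
    enum-inj  : ∀ i j → enum i ≈ enum j → i ≡ j

module _ (K : FiniteField) where
  open FiniteField K using (ring; size; enum)
  open CommutativeRing ring

  pow : Carrier → ℕ → Carrier
  pow x zero    = 1#
  pow x (suc k) = x * pow x k

  sumF : ∀ {n} → (Fin n → Carrier) → Carrier
  sumF {zero}  f = 0#
  sumF {suc n} f = f F.zero + sumF (λ i → f (F.suc i))

  Primitive : Carrier → Set
  Primitive x = ¬ (x ≈ 0#) × (∀ y → ¬ (y ≈ 0#) → Σ ℕ λ k → pow x k ≈ y)

  record Subfield : Set₁ where
    field
      mem      : Carrier → Set
      mem-resp : ∀ {x y} → x ≈ y → mem x → mem y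
      mem-0    : mem 0#
      mem-1    : mem 1#
      mem-+    : ∀ {x y} → mem x → mem y → mem (x + y)
      mem-*    : ∀ {x y} → mem x → mem y → mem (x * y)
      mem-neg  : ∀ {x} → mem x → mem (- x)
      mem-inv  : ∀ {x y} → mem x → x * y ≈ 1# → mem y

  HasCard : (Carrier → Set) → ℕ → Set
  HasCard S n = Σ (Fin n → Carrier) λ e →
    (∀ i → S (e i)) × (∀ i j → e i ≈ e j → i ≡ j) × (∀ x → S x → Σ (Fin n) λ i → e i ≈ x)

  IsBasisOver : (P : Carrier → Set) → (V : Carrier → Set) → ∀ {n} → (Fin n → Carrier) → Set
  IsBasisOver P V {n} α =
    (∀ i → V (α i)) ×
    (∀ (c : Fin n → Carrier) → (∀ i → P (c i)) → sumF (λ i → c i * α i) ≈ 0# → ∀ i → c i ≈ 0#) ×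
    (∀ x → V x → Σ (Fin n → Carrier) λ c → (∀ i → P (c i)) × sumF (λ i → c i * α i) ≈ x)

  InG : (P : Carrier → Set) → ∀ {n} → (α c : Fin n → Carrier) → Carrier → Set
  InG P {n} α c x = Σ (Fin n → Carrier) λ a →
    (∀ i → P (a i) × ¬ (a i ≈ c i)) × x ≈ sumF (λ i → a i * α i)

module Submission where

-- No characters are needed. Let n = q^r - 1, let H be the subgroup of d-th powers of Kˣ (d ∣ n) and let
-- g = d 1_H - 1 on Kˣ, g(0) = 0. For V ⊆ K the second moment of Φ(a, t) = Σ_{y ∈ V} g(a (y + t)) over all
-- a, t ∈ K is at most |V| n ‖g‖², because distinct points of V decorrelate. If V is a coset of an additive
-- subgroup U, then Φ(a, t) = Φ(1, 0) for a ∈ H and t ∈ U, so |H| |V| Φ(1, 0)² ≤ |V| n ‖g‖², which gives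
-- |Φ(1, 0)| ≤ d √n. Inclusion-exclusion over the r hyperplanes a_i = c_i turns this into the error 2^r √n for
-- d-th powers in G_A, and a Legendre sieve over the primes dividing n counts the primitive elements. The
-- result is N n ≥ φ(n) ((q-1)^r - 1 - 4^ω 2^r q^(r/2)), where 2^ω ≤ W(n). This is more than enough when
-- (q-1)² ≥ 2⁸ W(n)⁸ q, and in the remaining case the right-hand side of the claim is negative.

open import Defs
open import Algebra.Bundles using (CommutativeRing; RawRing)
open import Algebra.Core using (Op₁; Op₂)
open import Algebra.Morphism.Structures using (IsRingMonomorphism)
import Algebra.Morphism.RingMonomorphism as RingMonomorphism
import Algebra.Properties.CommutativeMonoid.Sum as MonoidSum
import Algebra.Properties.CommutativeSemigroup as CommutativeSemigroupProperties
import Algebra.Properties.CommutativeSemiring.Exp as Exp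
import Algebra.Properties.Ring as RingProperties
import Algebra.Solver.Ring.NaturalCoefficients.Default as SemiringSolver
open import Algebra.Structures using (IsCommutativeRing)
open import Data.Bool.Base using (Bool; true; false; _∧_; not; if_then_else_)
open import Data.Bool.ListAction using (all)
import Data.Bool.Properties as Bool
open import Data.Fin.Base as Fin using (Fin; zero; suc; toℕ; punchIn; finToFun; funToFin; _↑ˡ_)
open import Data.Fin.Permutation using (permutation)
import Data.Fin.Properties as Fin
open import Data.Integer.Base as ℤ using (ℤ; +_; -[1+_]; 0ℤ; 1ℤ; ∣_∣; +≤+)
import Data.Integer.Properties as ℤ
open import Data.Integer.Tactic.RingSolver using (solve-∀)
open import Data.List.Base using (List; []; _∷_; _++_; length; map; filter; upTo; applyUpTo; tabulate)
import Data.List.Properties as List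
open import Data.List.Membership.Propositional using (_∈_)
open import Data.List.Membership.Propositional.Properties using
    (∈-filter⁺; ∈-filter⁻; ∈-map⁺; ∈-map⁻; ∈-upTo⁺; ∈-++⁻; ∈-∃++; ∈-++⁺ˡ; ∈-++⁺ʳ)
open import Data.List.Relation.Unary.All as All using (All; []; _∷_)
import Data.List.Relation.Unary.All.Properties as All
open import Data.List.Relation.Unary.AllPairs using ([]; _∷_)
open import Data.List.Relation.Unary.Any using (here; there)
open import Data.List.Relation.Unary.Unique.Propositional using (Unique)
import Data.List.Relation.Unary.Unique.Propositional.Properties as Unique
open import Data.Nat.Base as ℕ using (ℕ; zero; suc)
open import Data.Nat.Coprimality using (Coprime; coprime⇒gcd≡1)
open import Data.Nat.DivMod using (m*n/n≡m)
open import Data.Nat.Divisibility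
open import Data.Nat.GCD using (gcd; gcd-greatest; gcd-GCD; gcd[m,n]∣m; gcd[m,n]∣n; module Bézout)
open import Data.Nat.ListAction using (product)
open import Data.Nat.ListAction.Properties using (product≢0)
open import Data.Nat.Primality using
    (Prime; ¬prime[0]; ¬prime[1]; prime?; prime⇒nonZero; prime⇒irreducible; euclidsLemma)
open import Data.Nat.Primality.Factorisation using (factorise; factorisationHasAllPrimeFactors)
import Data.Nat.Properties as ℕ
import Data.Nat.Tactic.RingSolver as ℕSolver
open import Data.Product.Base using (Σ; _×_; _,_; proj₁; proj₂; ∃)
open import Data.Sum.Base using (inj₁; inj₂)
open import Data.Unit.Base using (⊤; tt)
open import Function.Base using (_∘_; id)
open import Level using (0ℓ)
open import Relation.Binary.PropositionalEquality hiding (setoid)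
open import Relation.Nullary using (¬_; Dec; yes; no; does; contradiction)
open import Relation.Nullary.Decidable using (_×-dec_)
open import Algebra.Properties.Semiring.Sum ℤ.+-*-semiring
  using (sum; sum-cong-≗; ∑-comm; ∑-distrib-+; sum-permute; *-distribˡ-sum; *-distribʳ-sum; sum-init-last)

-- The maps x ↦ a (x + t) with a ≠ 0 carry an ordered pair of distinct points to every such pair
-- exactly once. Summed over all of them, the correlation of g at two distinct points is therefore
-- (Σ g)² - ‖g‖² = -‖g‖², because Σ g = 0, and a = 0 contributes g(0)² = 0. An affine V then profits
-- because the translations along its direction and the scalings by H all return the same value.
-- Everything stays in ℤ by clearing denominators: a count S of d-th powers enters as d S, and ∏ (1
-- - 1/p) enters as the pair of products Π of p and Π′ of p - 1. Since r is even, q^(r/2) is a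
-- natural number whose square is at least n, and it stands in for √n. The density φ(n)/n is needed
-- only through φ(n) Π ≤ n Π′, which the same sieve yields on [1, n]. In the error 4^ω one factor
-- 2^ω counts the terms of the sieve and the other bounds Π/Π′. The threshold (q-1)² against 2⁸
-- W(n)⁸ q is the eighth power of the condition that decides the sign of the bracket in the claim.

module _ where
  open import Data.Integer.Base using (_+_; _*_; _-_; _≤_)

  -- Indicators and finite sums with values in ℤ

  ⟦_⟧ : Bool → ℤ
  ⟦ true ⟧ = 1ℤ
  ⟦ false ⟧ = 0ℤ

  ⟦⟧-nonneg : ∀ b → 0ℤ ≤ ⟦ b ⟧
  ⟦⟧-nonneg true = +≤+ ℕ.z≤n
  ⟦⟧-nonneg false = ℤ.≤-refl

  ⟦⟧-≤1 : ∀ b → ⟦ b ⟧ ≤ 1ℤ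
  ⟦⟧-≤1 true = ℤ.≤-refl
  ⟦⟧-≤1 false = +≤+ ℕ.z≤n

  ⟦∧⟧ : ∀ a b → ⟦ a ∧ b ⟧ ≡ ⟦ a ⟧ * ⟦ b ⟧
  ⟦∧⟧ true b = sym (ℤ.*-identityˡ ⟦ b ⟧)
  ⟦∧⟧ false b = refl

  ⟦not⟧ : ∀ b → ⟦ not b ⟧ ≡ 1ℤ - ⟦ b ⟧
  ⟦not⟧ true = refl
  ⟦not⟧ false = refl

  ⟦⟧-mono : ∀ {a b} → (a ≡ true → b ≡ true) → ⟦ a ⟧ ≤ ⟦ b ⟧
  ⟦⟧-mono {true} a⇒b rewrite a⇒b refl = ℤ.≤-refl
  ⟦⟧-mono {false} {b} _ = ⟦⟧-nonneg b

  does⁻ : ∀ {a} {A : Set a} (d : Dec A) → does d ≡ true → A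
  does⁻ (yes a) _ = a

  does⁺ : ∀ {a} {A : Set a} (d : Dec A) → A → does d ≡ true
  does⁺ (yes _) _ = refl
  does⁺ (no ¬a) a = contradiction a ¬a

  does⁺-no : ∀ {a} {A : Set a} (d : Dec A) → ¬ A → does d ≡ false
  does⁺-no (yes a) ¬a = contradiction a ¬a
  does⁺-no (no _) _ = refl

  bool-iff : ∀ {a b} → (a ≡ true → b ≡ true) → (b ≡ true → a ≡ true) → a ≡ b
  bool-iff {true} {true} _ _ = refl
  bool-iff {false} {false} _ _ = refl
  bool-iff {true} {false} f _ = sym (f refl)
  bool-iff {false} {true} _ g = g refl

  *-nonneg : ∀ {i j} → 0ℤ ≤ i → 0ℤ ≤ j → 0ℤ ≤ i * j
  *-nonneg {+ m} {+ n} _ _ = ℤ.≤-trans (+≤+ ℕ.z≤n) (ℤ.≤-reflexive (ℤ.pos-* m n))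

  square-nonneg : ∀ i → 0ℤ ≤ i * i
  square-nonneg (+ n) = *-nonneg {+ n} {+ n} (+≤+ ℕ.z≤n) (+≤+ ℕ.z≤n)
  square-nonneg -[1+ n ] = +≤+ ℕ.z≤n

  *-monoˡ-nonneg : ∀ {i j k} → 0ℤ ≤ k → i ≤ j → k * i ≤ k * j
  *-monoˡ-nonneg {k = + m} _ i≤j = ℤ.*-monoˡ-≤-nonNeg (+ m) i≤j

  ⟦⟧*-≤ : ∀ b {i} → 0ℤ ≤ i → ⟦ b ⟧ * i ≤ i
  ⟦⟧*-≤ true {i} _ = ℤ.≤-reflexive (ℤ.*-identityˡ i)
  ⟦⟧*-≤ false 0≤i = 0≤i

  sum-mono : ∀ {n} {f g : Fin n → ℤ} → (∀ i → f i ≤ g i) → sum f ≤ sum g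
  sum-mono {zero} _ = ℤ.≤-refl
  sum-mono {suc n} f≤g = ℤ.+-mono-≤ (f≤g zero) (sum-mono (f≤g ∘ suc))

  sum-0 : ∀ {n} {f : Fin n → ℤ} → (∀ i → f i ≡ 0ℤ) → sum f ≡ 0ℤ
  sum-0 {zero} _ = refl
  sum-0 {suc n} f≡0 = cong₂ _+_ (f≡0 zero) (sum-0 (f≡0 ∘ suc))

  sum-nonneg : ∀ {n} {f : Fin n → ℤ} → (∀ i → 0ℤ ≤ f i) → 0ℤ ≤ sum f
  sum-nonneg {n} 0≤f = ℤ.≤-trans (ℤ.≤-reflexive (sym (sum-0 {n} (λ _ → refl)))) (sum-mono 0≤f)

  sum-const : ∀ n c → sum {n} (λ _ → c) ≡ + n * c
  sum-const zero c = refl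
  sum-const (suc n) c = trans (cong (_+_ c) (sum-const n c)) (sym (ℤ.suc-* (+ n) c))

  sum-distrib-- : ∀ {n} (f g : Fin n → ℤ) → sum (λ i → f i - g i) ≡ sum f - sum g
  sum-distrib-- {zero} f g = refl
  sum-distrib-- {suc n} f g = trans (cong (_+_ (f zero - g zero)) (sum-distrib-- (f ∘ suc) (g ∘ suc)))
    (shuffle (f zero) (g zero) (sum (f ∘ suc)) (sum (g ∘ suc)))
    where
    shuffle : ∀ a b c d → a - b + (c - d) ≡ a + c - (b + d)
    shuffle = solve-∀

  sum-bijection : ∀ {n} (F : Fin n → ℤ) (f g : Fin n → Fin n) →
                  (∀ x → f (g x) ≡ x) → (∀ x → g (f x) ≡ x) → sum (λ x → F (f x)) ≡ sum F
  sum-bijection F f g fg gf = sym (sum-permute F (permutation f g fg gf))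

  infix 4 _==_
  _==_ : ∀ {n} → Fin n → Fin n → Bool
  i == j = does (i Fin.≟ j)

  sum-δ : ∀ {n} (j : Fin n) (f : Fin n → ℤ) → sum (λ i → ⟦ i == j ⟧ * f i) ≡ f j
  sum-δ {suc n} zero f = begin
    1ℤ * f zero + sum {n} (λ i → 0ℤ) ≡⟨ cong₂ _+_ (ℤ.*-identityˡ (f zero)) (sum-0 {n} λ _ → refl) ⟩
    f zero + 0ℤ                      ≡⟨ ℤ.+-identityʳ _ ⟩
    f zero                           ∎
    where open ≡-Reasoning
  sum-δ {suc n} (suc j) f = trans (ℤ.+-identityˡ _) (sum-δ j (f ∘ suc))

  sum-== : ∀ {n} (j : Fin n) → sum (λ i → ⟦ i == j ⟧) ≡ 1ℤ
  sum-== {n} j = trans (sum-cong-≗ {n} (λ i → sym (ℤ.*-identityʳ ⟦ i == j ⟧))) (sum-δ j (λ _ → 1ℤ))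

  ==-sym : ∀ {n} (i j : Fin n) → (i == j) ≡ (j == i)
  ==-sym i j = bool-iff (λ h → does⁺ (j Fin.≟ i) (sym (does⁻ (i Fin.≟ j) h)))
                        (λ h → does⁺ (i Fin.≟ j) (sym (does⁻ (j Fin.≟ i) h)))

  term≤sum : ∀ {n} (f : Fin n → ℤ) → (∀ i → 0ℤ ≤ f i) → ∀ j → f j ≤ sum f
  term≤sum f 0≤f j = ℤ.≤-trans (ℤ.≤-reflexive (sym (sum-δ j f))) (sum-mono (λ i → ⟦⟧*-≤ (i == j) (0≤f i)))

  sum-indicator-image : ∀ {m n} (p : Fin m → Fin n) → (∀ i j → p i ≡ p j → i ≡ j) →
                        ∀ x → sum (λ i → ⟦ p i == x ⟧) ≡ ⟦ does (Fin.any? (λ i → p i Fin.≟ x)) ⟧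
  sum-indicator-image p inj x with Fin.any? (λ i → p i Fin.≟ x)
  ... | yes (i₀ , refl) = trans (sum-cong-≗ (λ i → cong ⟦_⟧ (bool-iff
      (λ h → does⁺ (i Fin.≟ i₀) (inj i i₀ (does⁻ (p i Fin.≟ p i₀) h)))
      (λ h → does⁺ (p i Fin.≟ p i₀) (cong p (does⁻ (i Fin.≟ i₀) h))))))
    (sum-== i₀)
  ... | no ∄ = sum-0 (λ i → cong ⟦_⟧ (does⁺-no (p i Fin.≟ x) (λ e → ∄ (i , e))))

  -- Double counting of the pairs (i, x) with p i = x, where injectivity caps every fibre at one.
  -- This will give the lower bound on the size of the box.
  injection⇒≤sum : ∀ {m n} (p : Fin m → Fin n) → (∀ i j → p i ≡ p j → i ≡ j) →
                   (w : Fin n → Bool) → (∀ i → w (p i) ≡ true) → + m ≤ sum (λ x → ⟦ w x ⟧)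
  injection⇒≤sum {m} {n} p inj w wp = begin
    + m                                           ≡⟨ ℤ.*-identityʳ (+ m) ⟨
    + m * 1ℤ                                      ≡⟨ sum-const m 1ℤ ⟨
    sum {m} (λ _ → 1ℤ)
        ≡⟨ sum-cong-≗ (λ i → trans (sum-cong-≗ {n} (λ x → cong ⟦_⟧ (==-sym (p i) x))) (sum-== (p i))) ⟨
    sum (λ i → sum (λ x → ⟦ p i == x ⟧))          ≡⟨ ∑-comm (λ i x → ⟦ p i == x ⟧) ⟩
    sum (λ x → sum (λ i → ⟦ p i == x ⟧))          ≡⟨ sum-cong-≗ (sum-indicator-image p inj) ⟩
    sum (λ x → ⟦ does (Fin.any? (λ i → p i Fin.≟ x)) ⟧) ≤⟨ sum-mono (λ x → ⟦⟧-mono (hit x)) ⟩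
    sum (λ x → ⟦ w x ⟧)                           ∎
    where
    open ℤ.≤-Reasoning
    hit : ∀ x → does (Fin.any? (λ i → p i Fin.≟ x)) ≡ true → w x ≡ true
    hit x h with does⁻ (Fin.any? (λ i → p i Fin.≟ x)) h
    ... | i , refl = wp i

  surjection⇒sum≤ : ∀ {m n} (p : Fin m → Fin n) → (w : Fin n → Bool) →
                    (∀ x → w x ≡ true → ∃ λ i → p i ≡ x) → sum (λ x → ⟦ w x ⟧) ≤ + m
  surjection⇒sum≤ {m} {n} p w surj = begin
    sum (λ x → ⟦ w x ⟧)                  ≤⟨ sum-mono covered ⟩
    sum (λ x → sum (λ i → ⟦ x == p i ⟧)) ≡⟨ ∑-comm (λ x i → ⟦ x == p i ⟧) ⟩
    sum (λ i → sum (λ x → ⟦ x == p i ⟧)) ≡⟨ sum-cong-≗ (λ i → sum-== (p i)) ⟩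
    sum {m} (λ _ → 1ℤ)                   ≡⟨ sum-const m 1ℤ ⟩
    + m * 1ℤ                             ≡⟨ ℤ.*-identityʳ (+ m) ⟩
    + m                                  ∎
    where
    open ℤ.≤-Reasoning
    covered : ∀ x → ⟦ w x ⟧ ≤ sum (λ i → ⟦ x == p i ⟧)
    covered x with w x in eq
    ... | false = sum-nonneg (λ i → ⟦⟧-nonneg (x == p i))
    ... | true with surj x eq
    ...   | i , refl = ℤ.≤-trans (ℤ.≤-reflexive (cong ⟦_⟧ (sym (does⁺ (p i Fin.≟ p i) refl))))
                         (term≤sum (λ j → ⟦ p i == p j ⟧) (λ j → ⟦⟧-nonneg (p i == p j)) i)

  -- The Legendre sieve over an abstract divisibility relation

  -- Every product that the sieve recursion visits divides n, and each new prime is coprime to what it multiplies.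
  data Siftable (n : ℕ) : ℕ → List ℕ → Set where
    nil  : ∀ {e} → e ∣ n → Siftable n e []
    cons : ∀ {e p ps} → Prime p → ¬ p ∣ e → Siftable n e ps → Siftable n (e ℕ.* p) ps → Siftable n e (p ∷ ps)

  siftable⇒∣ : ∀ {n e ps} → Siftable n e ps → e ∣ n
  siftable⇒∣ (nil e∣n) = e∣n
  siftable⇒∣ (cons _ _ s _) = siftable⇒∣ s

  -- For distinct primes this is Euler's function of their product.
  ∏∸1 : List ℕ → ℕ
  ∏∸1 ps = product (map ℕ.pred ps)

  -- Think of `h e x` as "e divides x". It becomes ordinary divisibility on [1, n] for the bound on
  -- φ, and membership among the e-th powers for elements of the field.
  module Sieve {X : Set} (n : ℕ) (h : ℕ → X → Bool)
    (h-* : ∀ {e p} → Prime p → ¬ p ∣ e → e ℕ.* p ∣ n → ∀ x → h (e ℕ.* p) x ≡ h e x ∧ h p x) where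

    -- The Möbius sum of μ(D) h(eD) over the square-free D composed of `ps`, unrolled one prime at a
    -- time.
    sift : List ℕ → ℕ → X → ℤ
    sift [] e x = ⟦ h e x ⟧
    sift (p ∷ ps) e x = sift ps e x - sift ps (e ℕ.* p) x

    survives : List ℕ → X → Bool
    survives ps x = all (λ p → not (h p x)) ps

    sift-survives : ∀ {e ps} → Siftable n e ps → ∀ x → sift ps e x ≡ ⟦ h e x ∧ survives ps x ⟧
    sift-survives (nil {e} _) x with h e x
    ... | true = refl
    ... | false = refl
    sift-survives (cons {e} {p} {ps} pr p∤e s s′) x
      rewrite sift-survives s x | sift-survives s′ x | h-* pr p∤e (siftable⇒∣ s′) x
      with h e x | h p x | survives ps x
    ... | true | true | true = refl
    ... | true | true | false = refl
    ... | true | false | true = refl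
    ... | true | false | false = refl
    ... | false | _ | _ = refl

  pred-pos : ∀ {p} → Prime p → + p ≡ 1ℤ + + ℕ.pred p
  pred-pos {suc p} _ = refl
  pred-pos {zero} pr = contradiction pr ¬prime[0]

  -- Reading p - 1 as a difference splits the main term between the two branches: p shares of Π′ T
  -- go to the branch without p and one share is taken back with the branch that contains p.
  sieve-step : ∀ (e p p′ Π Π′ A B T : ℤ) → p ≡ 1ℤ + p′ →
    e * (p * Π) * (A - B) - p′ * Π′ * T ≡ p * (e * Π * A - Π′ * T) - (e * p * Π * B - Π′ * T)
  sieve-step e _ p′ Π Π′ A B T refl = identity e p′ Π Π′ A B T
    where
    identity : ∀ e p′ Π Π′ A B T → e * ((1ℤ + p′) * Π) * (A - B) - p′ * Π′ * T ≡
      (1ℤ + p′) * (e * Π * A - Π′ * T) - (e * (1ℤ + p′) * Π * B - Π′ * T)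
    identity = solve-∀

  module _ {M : ℕ} (n : ℕ) (h : ℕ → Fin M → Bool)
    (h-* : ∀ {e p} → Prime p → ¬ p ∣ e → e ℕ.* p ∣ n → ∀ x → h (e ℕ.* p) x ≡ h e x ∧ h p x)
    (w : Fin M → ℤ) (T : ℤ) (E : ℕ)
    (equidistributed : ∀ {e} → e ∣ n → ∣ + e * sum (λ x → w x * ⟦ h e x ⟧) - T ∣ ℕ.≤ e ℕ.* E) where
    open Sieve n h h-*

    sum-sift-∷ : ∀ e p ps → sum (λ x → w x * sift (p ∷ ps) e x) ≡
      sum (λ x → w x * sift ps e x) - sum (λ x → w x * sift ps (e ℕ.* p) x)
    sum-sift-∷ e p ps = trans
      (sum-cong-≗ (λ x → distrib (w x) (sift ps e x) (sift ps (e ℕ.* p) x)))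
      (sum-distrib-- (λ x → w x * sift ps e x) (λ x → w x * sift ps (e ℕ.* p) x))
      where
      distrib : ∀ a b c → a * (b - c) ≡ a * b - a * c
      distrib = solve-∀

    -- Divided by e Π, this says that the sifted sum is (T / e) ∏ (1 - 1/p) with an error of E for
    -- each of the 2^k Möbius terms, k being the length of `ps`. The induction needs e general
    -- because the second branch moves p into it.
    sieve-bound : ∀ {e ps} → Siftable n e ps →
      ∣ + e * + product ps * sum (λ x → w x * sift ps e x) - + ∏∸1 ps * T ∣
        ℕ.≤ e ℕ.* product ps ℕ.* (2 ℕ.^ length ps ℕ.* E)
    sieve-bound (nil {e} e∣n) = begin
      ∣ + e * 1ℤ * S - 1ℤ * T ∣ ≡⟨ cong ∣_∣ (cong₂ _-_ (cong (_* S) (ℤ.*-identityʳ (+ e))) (ℤ.*-identityˡ T)) ⟩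
      ∣ + e * S - T ∣           ≤⟨ equidistributed e∣n ⟩
      e ℕ.* E                   ≡⟨ cong₂ ℕ._*_ (ℕ.*-identityʳ e) (ℕ.*-identityˡ E) ⟨
      e ℕ.* 1 ℕ.* (1 ℕ.* E)     ∎
      where
      open ℕ.≤-Reasoning
      S = sum (λ x → w x * ⟦ h e x ⟧)
    sieve-bound (cons {e} {p} {ps} pr p∤e s s′) = begin
      ∣ + e * + (p ℕ.* Π) * sum (λ x → w x * sift (p ∷ ps) e x) - + (ℕ.pred p ℕ.* Π′) * T ∣
        ≡⟨ cong₂ (λ u v → ∣ u - v * T ∣)
             (cong₂ (λ u v → + e * u * v) (ℤ.pos-* p Π) (sum-sift-∷ e p ps)) (ℤ.pos-* (ℕ.pred p) Π′) ⟩
      ∣ + e * (+ p * + Π) * (A - B) - + ℕ.pred p * + Π′ * T ∣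
        ≡⟨ cong ∣_∣ (sieve-step (+ e) (+ p) (+ ℕ.pred p) (+ Π) (+ Π′) A B T (pred-pos pr)) ⟩
      ∣ + p * (+ e * + Π * A - + Π′ * T) - (+ e * + p * + Π * B - + Π′ * T) ∣
        ≤⟨ ℤ.∣i-j∣≤∣i∣+∣j∣ (+ p * (+ e * + Π * A - + Π′ * T)) _ ⟩
      ∣ + p * (+ e * + Π * A - + Π′ * T) ∣ ℕ.+ ∣ + e * + p * + Π * B - + Π′ * T ∣
        ≡⟨ cong₂ ℕ._+_ (ℤ.abs-* (+ p) (+ e * + Π * A - + Π′ * T))
            (cong (λ u → ∣ u * + Π * B - + Π′ * T ∣) (sym (ℤ.pos-* e p))) ⟩
      p ℕ.* ∣ + e * + Π * A - + Π′ * T ∣ ℕ.+ ∣ + (e ℕ.* p) * + Π * B - + Π′ * T ∣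
        ≤⟨ ℕ.+-mono-≤ (ℕ.*-monoʳ-≤ p (sieve-bound s)) (sieve-bound s′) ⟩
      p ℕ.* (e ℕ.* Π ℕ.* (2^m ℕ.* E)) ℕ.+ e ℕ.* p ℕ.* Π ℕ.* (2^m ℕ.* E)
        ≡⟨ collect p e Π 2^m E ⟩
      e ℕ.* (p ℕ.* Π) ℕ.* (2 ℕ.* 2^m ℕ.* E) ∎
      where
      open ℕ.≤-Reasoning
      Π = product ps
      Π′ = ∏∸1 ps
      2^m = 2 ℕ.^ length ps
      A = sum (λ x → w x * sift ps e x)
      B = sum (λ x → w x * sift ps (e ℕ.* p) x)
      collect : ∀ p e Π c E → p ℕ.* (e ℕ.* Π ℕ.* (c ℕ.* E)) ℕ.+ e ℕ.* p ℕ.* Π ℕ.* (c ℕ.* E) ≡ e ℕ.* (p ℕ.* Π) ℕ.*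
          (2 ℕ.* c ℕ.* E)
      collect = ℕSolver.solve-∀

  -- Prime divisors, square-free divisors and products over them

  unique-⊆⇒length≤ : ∀ {A : Set} {xs ys : List A} → Unique xs → (∀ {x} → x ∈ xs → x ∈ ys) → length xs ℕ.≤ length ys
  unique-⊆⇒length≤ {xs = []} _ _ = ℕ.z≤n
  unique-⊆⇒length≤ {xs = x ∷ xs} (x≢ ∷ u) xs⊆ys with ∈-∃++ (xs⊆ys (here refl))
  ... | as , bs , refl = begin
    suc (length xs)             ≤⟨ ℕ.s≤s (unique-⊆⇒length≤ u rest) ⟩
    suc (length (as ++ bs))     ≡⟨ cong suc (List.length-++ as) ⟩
    suc (length as ℕ.+ length bs) ≡⟨ ℕ.+-suc (length as) (length bs) ⟨
    length as ℕ.+ length (x ∷ bs) ≡⟨ List.length-++ as ⟨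
    length (as ++ x ∷ bs)       ∎
    where
    open ℕ.≤-Reasoning
    rest : ∀ {y} → y ∈ xs → y ∈ as ++ bs
    rest y∈xs with ∈-++⁻ as (xs⊆ys (there y∈xs))
    ... | inj₁ y∈as = ∈-++⁺ˡ y∈as
    ... | inj₂ (here refl) = contradiction refl (All.lookup x≢ y∈xs)
    ... | inj₂ (there y∈bs) = ∈-++⁺ʳ as y∈bs

  ∈-oneTo⁺ : ∀ {n d} → 1 ℕ.≤ d → d ℕ.≤ n → d ∈ oneTo n
  ∈-oneTo⁺ {d = suc d} _ d<n = ∈-map⁺ suc (∈-upTo⁺ d<n)

  ∣⇒∈-oneTo : ∀ {n d} .{{_ : ℕ.NonZero n}} → d ∣ n → d ∈ oneTo n
  ∣⇒∈-oneTo {n} {zero} 0∣n = contradiction (0∣⇒≡0 0∣n) (ℕ.≢-nonZero⁻¹ n)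
  ∣⇒∈-oneTo {d = suc d} d∣n = ∈-oneTo⁺ (ℕ.s≤s ℕ.z≤n) (∣⇒≤ d∣n)

  oneTo-unique : ∀ n → Unique (oneTo n)
  oneTo-unique n = Unique.map⁺ ℕ.suc-injective (Unique.upTo⁺ n)

  prime∣prime⇒≡ : ∀ {p q} → Prime p → Prime q → p ∣ q → p ≡ q
  prime∣prime⇒≡ p-prime q-prime p∣q with prime⇒irreducible q-prime p∣q
  ... | inj₁ refl = contradiction p-prime ¬prime[1]
  ... | inj₂ p≡q = p≡q

  ∃-prime-divisor : ∀ m → 2 ℕ.≤ m → ∃ λ p → Prime p × p ∣ m
  ∃-prime-divisor m@(suc m-1) 2≤m with factorise m
  ... | record { factors = []; isFactorisation = refl } = contradiction 2≤m λ { (ℕ.s≤s ()) }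
  ... | record { factors = p ∷ ps; isFactorisation = m≡ ; factorsPrime = p-prime ∷ _ } =
    p , p-prime , subst (p ∣_) (sym m≡) (m∣m*n (product ps))

  primeDivisors : ℕ → List ℕ
  primeDivisors n = filter (λ p → prime? p ×-dec p ∣? n) (oneTo n)

  primeDivisors-unique : ∀ n → Unique (primeDivisors n)
  primeDivisors-unique n = Unique.filter⁺ (λ p → prime? p ×-dec p ∣? n) (oneTo-unique n)

  primeDivisors-sound : ∀ n {p} → p ∈ primeDivisors n → Prime p × p ∣ n
  primeDivisors-sound n p∈ = proj₂ (∈-filter⁻ (λ p → prime? p ×-dec p ∣? n) {xs = oneTo n} p∈)

  primeDivisors-complete : ∀ n .{{_ : ℕ.NonZero n}} {p} → Prime p → p ∣ n → p ∈ primeDivisors n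
  primeDivisors-complete n p-prime p∣n =
    ∈-filter⁺ (λ p → prime? p ×-dec p ∣? n) (∣⇒∈-oneTo p∣n) (p-prime , p∣n)

  -- Distinctness enters through Euclid's lemma. Once n = k Π, a further prime p dividing n divides
  -- k, because dividing Π would make it one of the primes already in the list.
  primes-product-∣ : ∀ {n ps} → Unique ps → All (λ p → Prime p × p ∣ n) ps → product ps ∣ n
  primes-product-∣ {n} [] [] = 1∣ n
  primes-product-∣ {n} {p ∷ ps} (p≢ ∷ u) ((p-prime , p∣n) ∷ all-ps) with primes-product-∣ u all-ps
  ... | divides k refl with euclidsLemma k (product ps) p-prime p∣n
  ...   | inj₁ (divides j refl) = divides j (ℕ.*-assoc j p (product ps))
  ...   | inj₂ p∣Π = contradiction refl
            (All.lookup p≢ (factorisationHasAllPrimeFactors p-prime p∣Π (All.map proj₁ all-ps)))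

  -- Squares of primes are a sufficient test: any m ≥ 2 has a prime factor ℓ, and m² ∣ d forces ℓ² ∣
  -- d.
  product-squarefree : ∀ {ps ℓ} → Unique ps → All Prime ps → Prime ℓ → ¬ ℓ ℕ.* ℓ ∣ product ps
  product-squarefree [] [] ℓ-prime ℓ²∣1 = contradiction (subst Prime (∣1⇒≡1 (m*n∣⇒m∣ _ _ ℓ²∣1)) ℓ-prime) ¬prime[1]
  product-squarefree {p ∷ ps} {ℓ} (p≢ ∷ u) (p-prime ∷ ps-prime) ℓ-prime ℓ²∣ with ℓ ℕ.≟ p
  ... | yes refl = contradiction refl (All.lookup p≢ (factorisationHasAllPrimeFactors ℓ-prime
        (*-cancelˡ-∣ ℓ {{prime⇒nonZero ℓ-prime}} ℓ²∣) ps-prime))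
  ... | no ℓ≢p with euclidsLemma p (product ps) ℓ-prime (∣-trans (m∣m*n ℓ) ℓ²∣)
  ...   | inj₁ ℓ∣p = contradiction (prime∣prime⇒≡ ℓ-prime p-prime ℓ∣p) ℓ≢p
  ...   | inj₂ (divides k Π≡kℓ) with euclidsLemma p k ℓ-prime ℓ∣pk
    where
    ℓ∣pk : ℓ ∣ p ℕ.* k
    ℓ∣pk = *-cancelʳ-∣ ℓ {{prime⇒nonZero ℓ-prime}}
      (subst (ℓ ℕ.* ℓ ∣_) (trans (cong (p ℕ.*_) Π≡kℓ) (sym (ℕ.*-assoc p k ℓ))) ℓ²∣)
  ...     | inj₁ ℓ∣p = contradiction (prime∣prime⇒≡ ℓ-prime p-prime ℓ∣p) ℓ≢p
  ...     | inj₂ ℓ∣k = product-squarefree u ps-prime ℓ-prime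
            (subst (ℓ ℕ.* ℓ ∣_) (sym Π≡kℓ) (*-monoˡ-∣ ℓ ℓ∣k))

  -- One product for each sublist. For the prime divisors of n these are 2^ω pairwise distinct
  -- square-free divisors, which is how W(n) is bounded from below.
  subproducts : List ℕ → List ℕ
  subproducts [] = 1 ∷ []
  subproducts (p ∷ ps) = subproducts ps ++ map (p ℕ.*_) (subproducts ps)

  length-subproducts : ∀ ps → length (subproducts ps) ≡ 2 ℕ.^ length ps
  length-subproducts [] = refl
  length-subproducts (p ∷ ps) = begin
    length (subproducts ps ++ map (p ℕ.*_) (subproducts ps)) ≡⟨ List.length-++ (subproducts ps) ⟩
    length (subproducts ps) ℕ.+ length (map (p ℕ.*_) (subproducts ps))
      ≡⟨ cong₂ ℕ._+_ (length-subproducts ps)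
          (trans (List.length-map (p ℕ.*_) (subproducts ps)) (length-subproducts ps)) ⟩
    2 ℕ.^ length ps ℕ.+ 2 ℕ.^ length ps ≡⟨ cong (2 ℕ.^ length ps ℕ.+_) (ℕ.+-identityʳ _) ⟨
    2 ℕ.* 2 ℕ.^ length ps ∎
    where open ≡-Reasoning

  subproducts-∣ : ∀ ps {d} → d ∈ subproducts ps → d ∣ product ps
  subproducts-∣ [] (here refl) = ∣-refl
  subproducts-∣ (p ∷ ps) d∈ with ∈-++⁻ (subproducts ps) d∈
  ... | inj₁ d∈ˡ = ∣n⇒∣m*n p (subproducts-∣ ps d∈ˡ)
  ... | inj₂ d∈ʳ with ∈-map⁻ (p ℕ.*_) d∈ʳ
  ...   | d′ , d′∈ , refl = *-monoʳ-∣ p (subproducts-∣ ps d′∈)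

  subproducts-unique : ∀ {ps} → Unique ps → All Prime ps → Unique (subproducts ps)
  subproducts-unique [] [] = [] ∷ []
  subproducts-unique {p ∷ ps} (p≢ ∷ u) (p-prime ∷ ps-prime) =
    Unique.++⁺ ih (Unique.map⁺ (λ {x} {y} → ℕ.*-cancelˡ-≡ x y p {{prime⇒nonZero p-prime}}) ih) disjoint
    where
    ih = subproducts-unique u ps-prime
    disjoint : ∀ {d} → ¬ (d ∈ subproducts ps × d ∈ map (p ℕ.*_) (subproducts ps))
    disjoint (d∈ˡ , d∈ʳ) with ∈-map⁻ (p ℕ.*_) d∈ʳ
    ... | d′ , _ , refl = contradiction refl (All.lookup p≢
      (factorisationHasAllPrimeFactors p-prime (∣-trans (m∣m*n d′) (subproducts-∣ ps d∈ˡ)) ps-prime))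

  module _ (n : ℕ) .{{_ : ℕ.NonZero n}} where
    private
      ps = primeDivisors n

      ps-sound : All (λ p → Prime p × p ∣ n) ps
      ps-sound = All.tabulate (primeDivisors-sound n)

      ps-prime : All Prime ps
      ps-prime = All.map proj₁ ps-sound

    2^ω≤W : 2 ℕ.^ length (primeDivisors n) ℕ.≤ W n
    2^ω≤W = ℕ.≤-trans (ℕ.≤-reflexive (sym (length-subproducts ps)))
      (unique-⊆⇒length≤ (subproducts-unique (primeDivisors-unique n) ps-prime) counted)
      where
      counted : ∀ {d} → d ∈ subproducts ps → d ∈ filter (λ d → (d ∣? n) ×-dec squarefree? d) (oneTo n)
      counted {d} d∈ = ∈-filter⁺ (λ d → (d ∣? n) ×-dec squarefree? d) (∣⇒∈-oneTo d∣n) (d∣n , All.tabulate squarefree)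
        where
        d∣Π = subproducts-∣ ps d∈
        d∣n = ∣-trans d∣Π (primes-product-∣ (primeDivisors-unique n) ps-sound)
        squarefree : ∀ {m} → m ∈ map (ℕ._+ 2) (upTo d) → ¬ m ℕ.* m ∣ d
        squarefree m∈ m²∣d with ∈-map⁻ (ℕ._+ 2) m∈
        ... | k , _ , refl with ∃-prime-divisor (k ℕ.+ 2) (ℕ.m≤n+m 2 k)
        ...   | ℓ , ℓ-prime , ℓ∣m = product-squarefree (primeDivisors-unique n) ps-prime ℓ-prime
                  (∣-trans (*-pres-∣ ℓ∣m ℓ∣m) (∣-trans m²∣d d∣Π))

    primeDivisors-siftable : Siftable n 1 (primeDivisors n)
    primeDivisors-siftable = siftable (primeDivisors-unique n) ps-prime
      (All.map (λ p-prime p∣1 → ¬prime[1] (subst Prime (∣1⇒≡1 p∣1) p-prime)) ps-prime)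
      (subst (_∣ n) (sym (ℕ.*-identityˡ (product ps))) (primes-product-∣ (primeDivisors-unique n) ps-sound))
      where
      siftable : ∀ {e qs} → Unique qs → All Prime qs → All (λ q → ¬ q ∣ e) qs → e ℕ.* product qs ∣ n → Siftable n e qs
      siftable {e} [] [] [] e∣n = nil (subst (_∣ n) (ℕ.*-identityʳ e) e∣n)
      siftable {e} {q ∷ qs} (q≢ ∷ u) (q-prime ∷ qs-prime) (q∤e ∷ qs∤e) eΠ∣n = cons q-prime q∤e
        (siftable u qs-prime qs∤e (∣-trans (*-monoʳ-∣ e (n∣m*n q)) eΠ∣n))
        (siftable u qs-prime (All.tabulate avoids) (subst (_∣ n) (sym (ℕ.*-assoc e q (product qs))) eΠ∣n))
        where
        avoids : ∀ {ℓ} → ℓ ∈ qs → ¬ ℓ ∣ e ℕ.* q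
        avoids {ℓ} ℓ∈qs ℓ∣eq with euclidsLemma e q (All.lookup qs-prime ℓ∈qs) ℓ∣eq
        ... | inj₁ ℓ∣e = All.lookup qs∤e ℓ∈qs ℓ∣e
        ... | inj₂ ℓ∣q = All.lookup q≢ ℓ∈qs (sym (prime∣prime⇒≡ (All.lookup qs-prime ℓ∈qs) q-prime ℓ∣q))

    -- Every prime satisfies p ≤ 2 (p - 1). The inequality lets the sieve error, a multiple of Π, be
    -- absorbed into a multiple of Π′.
    product≤∏∸1*2^ω : product (primeDivisors n) ℕ.≤ ∏∸1 (primeDivisors n) ℕ.* 2 ℕ.^ length (primeDivisors n)
    product≤∏∸1*2^ω = bound ps-prime
      where
      bound : ∀ {qs} → All Prime qs → product qs ℕ.≤ ∏∸1 qs ℕ.* 2 ℕ.^ length qs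
      bound [] = ℕ.≤-refl
      bound {q ∷ qs} (q-prime ∷ qs-prime) = begin
        q ℕ.* product qs ≤⟨ ℕ.*-mono-≤ (double q q-prime) (bound qs-prime) ⟩
        2 ℕ.* ℕ.pred q ℕ.* (∏∸1 qs ℕ.* 2 ℕ.^ length qs) ≡⟨ rearr (ℕ.pred q) (∏∸1 qs) (2 ℕ.^ length qs) ⟩
        ℕ.pred q ℕ.* ∏∸1 qs ℕ.* (2 ℕ.* 2 ℕ.^ length qs) ∎
        where
        open ℕ.≤-Reasoning
        rearr : ∀ a b c → 2 ℕ.* a ℕ.* (b ℕ.* c) ≡ a ℕ.* b ℕ.* (2 ℕ.* c)
        rearr = ℕSolver.solve-∀
        double : ∀ q → Prime q → q ℕ.≤ 2 ℕ.* ℕ.pred q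
        double 0 q-prime = ℕ.z≤n
        double 1 q-prime = contradiction q-prime ¬prime[1]
        double (suc (suc q)) q-prime = ℕ.s≤s (ℕ.≤-trans (ℕ.s≤s (ℕ.m≤m+n q _)) (ℕ.≤-reflexive (sym (ℕ.+-suc q _))))

    product-primeDivisors≢0 : ℕ.NonZero (product (primeDivisors n))
    product-primeDivisors≢0 = product≢0 (All.map prime⇒nonZero ps-prime)

  -- Positivity of φ keeps the final comparison strict after multiplication by φ⁸.
  φ≥1 : ∀ n → 1 ℕ.≤ n → 1 ℕ.≤ φ n
  φ≥1 n 1≤n = unique-⊆⇒length≤ {xs = 1 ∷ []} ([] ∷ []) λ { (here refl) →
    ∈-filter⁺ (λ k → gcd k n ℕ.≟ 1) (∈-oneTo⁺ ℕ.≤-refl 1≤n) (coprime⇒gcd≡1 {1} {n} (λ (d∣1 , _) → ∣1⇒≡1 d∣1)) }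

  -- The sieve upper bound for φ

  length-filter-applyUpTo : ∀ {P : ℕ → Set} (P? : ∀ k → Dec (P k)) f n →
    + length (filter P? (applyUpTo f n)) ≡ sum {n} (λ i → ⟦ does (P? (f (toℕ i))) ⟧)
  length-filter-applyUpTo P? f zero = refl
  length-filter-applyUpTo P? f (suc n) with does (P? (f 0))
  ... | true = cong (_+_ 1ℤ) (length-filter-applyUpTo P? (f ∘ suc) n)
  ... | false = trans (length-filter-applyUpTo P? (f ∘ suc) n) (sym (ℤ.+-identityˡ _))

  sum-toℕ-suc : ∀ n (f : ℕ → ℤ) → sum {suc n} (f ∘ toℕ) ≡ sum {n} (f ∘ toℕ) + f n
  sum-toℕ-suc n f = trans (sum-init-last {n} (f ∘ toℕ))
    (cong₂ _+_ (sum-cong-≗ {n} (λ i → cong f (Fin.toℕ-inject₁ i))) (cong f (Fin.toℕ-fromℕ n)))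

  module _ (e-1 : ℕ) where
    private e = suc e-1

    indicator : ℕ → ℤ
    indicator k = ⟦ does (e ∣? suc k) ⟧

    -- The count is carried together with a remainder so that the induction on n closes: the next
    -- integer either completes a block of length e and is a multiple of e, or it increases the
    -- remainder.
    sum-multiples : ∀ n → ∃ λ c → ∃ λ r →
      sum {n} (λ i → ⟦ does (e ∣? suc (toℕ i)) ⟧) ≡ + c × n ≡ c ℕ.* e ℕ.+ r × r ℕ.< e
    sum-multiples zero = 0 , 0 , refl , refl , ℕ.s≤s ℕ.z≤n
    sum-multiples (suc n) with sum-multiples n
    ... | c , r , sum≡ , n≡ , r<e with suc r ℕ.≟ e
    ...   | yes refl = suc c , 0 ,
        trans (sum-toℕ-suc n indicator)
            (trans (cong₂ _+_ sum≡ (cong ⟦_⟧ (does⁺ (e ∣? suc n) (divides (suc c) suc-n≡))))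
          (trans (sym (ℤ.pos-+ c 1)) (cong +_ (ℕ.+-comm c 1)))) ,
        trans suc-n≡ (sym (ℕ.+-identityʳ _)) , ℕ.s≤s ℕ.z≤n
      where
      suc-n≡ : suc n ≡ suc c ℕ.* e
      suc-n≡ = trans (cong suc n≡) (trans (sym (ℕ.+-suc (c ℕ.* e) r)) (ℕ.+-comm (c ℕ.* e) e))
    ...   | no r+1≢e = c , suc r ,
        trans (sum-toℕ-suc n indicator)
            (trans (cong₂ _+_ sum≡ (cong ⟦_⟧ (does⁺-no (e ∣? suc n) ∤))) (ℤ.+-identityʳ _)) ,
        suc-n≡ , r+1<e
      where
      r+1<e = ℕ.≤∧≢⇒< r<e r+1≢e
      suc-n≡ : suc n ≡ c ℕ.* e ℕ.+ suc r
      suc-n≡ = trans (cong suc n≡) (sym (ℕ.+-suc (c ℕ.* e) r))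
      ∤ : ¬ e ∣ suc n
      ∤ e∣ = ℕ.<⇒≱ r+1<e (∣⇒≤ (∣m+n∣m⇒∣n (subst (e ∣_) suc-n≡ e∣) (n∣m*n c)))

  ∣∧<⇒≡0 : ∀ {d r} → d ∣ r → r ℕ.< d → r ≡ 0
  ∣∧<⇒≡0 {r = zero} _ _ = refl
  ∣∧<⇒≡0 {r = suc _} d∣r r<d = contradiction (∣⇒≤ d∣r) (ℕ.<⇒≱ r<d)

  prime∤⇒coprime : ∀ {p e} → Prime p → ¬ p ∣ e → Coprime e p
  prime∤⇒coprime p-prime p∤e (d∣e , d∣p) with prime⇒irreducible p-prime d∣p
  ... | inj₁ d≡1 = d≡1
  ... | inj₂ refl = contradiction d∣e p∤e

  module _ (n : ℕ) .{{_ : ℕ.NonZero n}} where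
    private
      divs : ℕ → Fin n → Bool
      divs e i = does (e ∣? suc (toℕ i))

      divs-* : ∀ {e p} → Prime p → ¬ p ∣ e → e ℕ.* p ∣ n → ∀ i → divs (e ℕ.* p) i ≡ divs e i ∧ divs p i
      divs-* {e} {p} p-prime p∤e _ i = bool-iff to from
        where
        k = suc (toℕ i)
        to : divs (e ℕ.* p) i ≡ true → divs e i ∧ divs p i ≡ true
        to h = let ep∣k = does⁻ (e ℕ.* p ∣? k) h in
          cong₂ _∧_ (does⁺ (e ∣? k) (m*n∣⇒m∣ e p ep∣k)) (does⁺ (p ∣? k) (m*n∣⇒n∣ e p ep∣k))
        from : divs e i ∧ divs p i ≡ true → divs (e ℕ.* p) i ≡ true
        from h with e ∣? k | p ∣? k
        ... | yes (divides j k≡je) | yes p∣k = does⁺ (e ℕ.* p ∣? k)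
            (subst (e ℕ.* p ∣_) (trans (ℕ.*-comm e j) (sym k≡je)) (*-monoʳ-∣ e p∣j))
          where
          p∣j : p ∣ j
          p∣j with euclidsLemma j e p-prime (subst (p ∣_) k≡je p∣k)
          ... | inj₁ p∣j = p∣j
          ... | inj₂ p∣e = contradiction p∣e p∤e
        ... | yes _ | no _ = contradiction h (λ ())
        ... | no _ | _ = contradiction h (λ ())

      -- The remainder left by `sum-multiples` is a multiple of e below e, hence 0. The sieve can
      -- therefore be run with T = n and E = 0.
      exact : ∀ {e} → e ∣ n → ∣ + e * sum {n} (λ i → 1ℤ * ⟦ divs e i ⟧) - + n ∣ ℕ.≤ e ℕ.* 0
      exact {zero} 0∣n = contradiction (0∣⇒≡0 0∣n) (ℕ.≢-nonZero⁻¹ n)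
      exact {e@(suc e-1)} e∣n with sum-multiples e-1 n
      ... | c , r , sum≡ , n≡ , r<e = ℕ.≤-reflexive (trans (cong ∣_∣ zero-diff) (sym (ℕ.*-zeroʳ e)))
        where
        e∣r : e ∣ r
        e∣r = ∣m+n∣m⇒∣n (subst (e ∣_) n≡ e∣n) (n∣m*n c)
        r≡0 = ∣∧<⇒≡0 e∣r r<e
        zero-diff : + e * sum {n} (λ i → 1ℤ * ⟦ divs e i ⟧) - + n ≡ 0ℤ
        zero-diff = ℤ.i≡j⇒i-j≡0 (begin
          + e * sum {n} (λ i → 1ℤ * ⟦ divs e i ⟧)
              ≡⟨ cong (+ e *_) (sum-cong-≗ {n} (λ i → ℤ.*-identityˡ ⟦ divs e i ⟧)) ⟩
          + e * sum {n} (λ i → ⟦ divs e i ⟧)      ≡⟨ cong (+ e *_) sum≡ ⟩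
          + e * + c                               ≡⟨ ℤ.pos-* e c ⟨
          + (e ℕ.* c)
              ≡⟨ cong +_ (trans (ℕ.*-comm e c) (sym (trans n≡ (trans (cong (c ℕ.* e ℕ.+_) r≡0) (ℕ.+-identityʳ _))))) ⟩
          + n                                     ∎)
          where open ≡-Reasoning

      ps = primeDivisors n

      open Sieve n divs divs-*

      -- A prime dividing both k and n would divide their gcd, which is 1. This inclusion is the
      -- direction that an upper bound on φ asks for.
      coprime⇒survives : ∀ i → does (gcd (suc (toℕ i)) n ℕ.≟ 1) ≡ true → divs 1 i ∧ survives ps i ≡ true
      coprime⇒survives i h = cong₂ _∧_ (does⁺ (1 ∣? suc (toℕ i)) (1∣ _))
          (all-survive (All.tabulate (primeDivisors-sound n)))
        where
        k = suc (toℕ i)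
        all-survive : ∀ {qs} → All (λ q → Prime q × q ∣ n) qs → survives qs i ≡ true
        all-survive [] = refl
        all-survive {q ∷ qs} ((q-prime , q∣n) ∷ r) = cong₂ _∧_ (cong not (does⁺-no (q ∣? k) λ q∣k →
          ¬prime[1] (subst Prime (∣1⇒≡1 (subst (q ∣_) (does⁻ (gcd k n ℕ.≟ 1) h) (gcd-greatest q∣k q∣n))) q-prime)))
          (all-survive r)

    -- The same sieve on [1, n], where the multiples of e ∣ n are counted without error.
    φ-upper : φ n ℕ.* product (primeDivisors n) ℕ.≤ n ℕ.* ∏∸1 (primeDivisors n)
    φ-upper = ℤ.drop‿+≤+ (begin
      + (φ n ℕ.* Π)                            ≡⟨ cong +_ (ℕ.*-comm (φ n) Π) ⟩
      + (Π ℕ.* φ n)                            ≡⟨ ℤ.pos-* Π (φ n) ⟩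
      + Π * + φ n                              ≤⟨ *-monoˡ-nonneg {k = + Π} (+≤+ ℕ.z≤n) φ≤S ⟩
      + Π * S                                  ≡⟨ cong (_* S) (ℤ.*-identityˡ (+ Π)) ⟨
      1ℤ * + Π * S                             ≡⟨ ℤ.i-j≡0⇒i≡j _ _ (ℤ.∣i∣≡0⇒i≡0 (ℕ.n≤0⇒n≡0 (ℕ.≤-trans
                                                     (sieve-bound n divs divs-* (λ _ → 1ℤ) (+ n) 0 exact
                                                         (primeDivisors-siftable n))
                                                     (ℕ.≤-reflexive no-error)))) ⟩
      + ∏∸1 ps * + n                           ≡⟨ ℤ.pos-* (∏∸1 ps) n ⟨
      + (∏∸1 ps ℕ.* n)                         ≡⟨ cong +_ (ℕ.*-comm (∏∸1 ps) n) ⟩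
      + (n ℕ.* ∏∸1 ps)                         ∎)
      where
      open ℤ.≤-Reasoning
      Π = product ps
      S = sum {n} (λ i → 1ℤ * sift ps 1 i)
      no-error : 1 ℕ.* Π ℕ.* (2 ℕ.^ length ps ℕ.* 0) ≡ 0
      no-error = trans (cong (1 ℕ.* Π ℕ.*_) (ℕ.*-zeroʳ (2 ℕ.^ length ps))) (ℕ.*-zeroʳ (1 ℕ.* Π))
      φ≤S : + φ n ≤ S
      φ≤S = begin
        + φ n ≡⟨ cong (λ l → + length (filter (λ k → gcd k n ℕ.≟ 1) l)) (List.map-applyUpTo id suc n) ⟩
        + length (filter (λ k → gcd k n ℕ.≟ 1) (applyUpTo suc n))
            ≡⟨ length-filter-applyUpTo (λ k → gcd k n ℕ.≟ 1) suc n ⟩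
        sum {n} (λ i → ⟦ does (gcd (suc (toℕ i)) n ℕ.≟ 1) ⟧) ≤⟨ sum-mono {n} (λ i → ⟦⟧-mono (coprime⇒survives i)) ⟩
        sum {n} (λ i → ⟦ divs 1 i ∧ survives ps i ⟧)
            ≡⟨ sum-cong-≗ {n} (λ i → trans (sym (sift-survives (primeDivisors-siftable n) i))
                (sym (ℤ.*-identityˡ (sift ps 1 i)))) ⟩
        S ∎

-- Numerical estimates

module _ where
  open import Data.Nat.Base
  open import Data.Nat.Properties

  ^-distribʳ-* : ∀ k a b → (a * b) ^ k ≡ a ^ k * b ^ k
  ^-distribʳ-* zero a b = refl
  ^-distribʳ-* (suc k) a b = trans (cong (a * b *_) (^-distribʳ-* k a b))
      ([m*n]*[o*p]≡[m*o]*[n*p] a b (a ^ k) (b ^ k))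

  -- A discrete mean value inequality: the gap between consecutive powers is at most the derivative
  -- at the right end.
  suc^≤^+*suc^ : ∀ m k → suc m ^ suc k ≤ m ^ suc k + suc k * suc m ^ k
  suc^≤^+*suc^ m zero = ≤-reflexive (identity m)
    where
    identity : ∀ m → suc m * 1 ≡ m * 1 + 1 * 1
    identity = ℕSolver.solve-∀
  suc^≤^+*suc^ m (suc k) = begin
    suc m * suc m ^ suc k                                          ≡⟨⟩
    suc m ^ suc k + m * suc m ^ suc k
        ≤⟨ +-monoʳ-≤ (suc m ^ suc k) (*-monoʳ-≤ m (suc^≤^+*suc^ m k)) ⟩
    suc m ^ suc k + m * (m ^ suc k + suc k * suc m ^ k)
        ≤⟨ +-monoʳ-≤ (suc m ^ suc k)
            (≤-trans (≤-reflexive (expand m (m ^ suc k) k (suc m ^ k)))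
                (+-monoʳ-≤ (m * m ^ suc k) (*-monoʳ-≤ (suc k) (*-monoˡ-≤ (suc m ^ k) (n≤1+n m))))) ⟩
    suc m ^ suc k + (m * m ^ suc k + suc k * (suc m * suc m ^ k))  ≡⟨ collect (suc m ^ suc k) (m * m ^ suc k) k ⟩
    m ^ suc (suc k) + suc (suc k) * suc m ^ suc k                  ∎
    where
    open ≤-Reasoning
    expand : ∀ m a k b → m * (a + suc k * b) ≡ m * a + suc k * (m * b)
    expand = ℕSolver.solve-∀
    collect : ∀ a b k → a + (b + suc k * a) ≡ b + suc (suc k) * a
    collect = ℕSolver.solve-∀

  floor-root : ∀ k t → ∃ λ m → m ^ suc k ≤ t × t < suc m ^ suc k
  floor-root k zero = 0 , z≤n , >-nonZero⁻¹ (1 ^ suc k) {{m^n≢0 1 (suc k)}}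
  floor-root k (suc t) with floor-root k t
  ... | m , mᵏ≤t , t<m+1ᵏ with suc t <? suc m ^ suc k
  ...   | yes t+1<m+1ᵏ = m , m≤n⇒m≤1+n mᵏ≤t , t+1<m+1ᵏ
  ...   | no t+1≮m+1ᵏ = suc m , ≮⇒≥ t+1≮m+1ᵏ , ≤-<-trans t<m+1ᵏ (^-monoˡ-< (suc k) (n<1+n (suc m)))

  -- With d this large, consecutive powers near v dᵏ⁺¹ differ by at most dᵏ⁺¹.
  rational-root-between : ∀ k {u v} d → 1 ≤ d → d ≡ suc k * suc v ^ k → v < u →
    ∃ λ m → m ^ suc k ≤ u * d ^ suc k × v * d ^ suc k < m ^ suc k
  rational-root-between k {u} {v} d 1≤d d≡ v<u with floor-root k (u * d ^ suc k)
  ... | m , mᵏ≤udᵏ , udᵏ<m+1ᵏ = m , mᵏ≤udᵏ , vdᵏ<mᵏ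
    where
    vdᵏ<mᵏ : v * d ^ suc k < m ^ suc k
    vdᵏ<mᵏ with v * d ^ suc k <? m ^ suc k
    ... | yes lt = lt
    -- If m^(k+1) were at most v d^(k+1), then m ≤ v d and m + 1 ≤ (v + 1) d. The gap to the next
    -- power is then at most (k+1) ((v+1) d)^k, which is d^(k+1) by the choice of d. So (m+1)^(k+1)
    -- would not exceed u d^(k+1), although m is the floor of the root.
    ... | no nlt = contradiction udᵏ<m+1ᵏ (≤⇒≯ (begin
      suc m ^ suc k                                ≤⟨ suc^≤^+*suc^ m k ⟩
      m ^ suc k + suc k * suc m ^ k                ≤⟨ +-mono-≤ mᵏ≤ (*-monoʳ-≤ (suc k) (^-monoˡ-≤ k m+1≤)) ⟩
      v * d ^ suc k + suc k * (suc v * d) ^ k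
          ≡⟨ cong (_+_ (v * d ^ suc k))
              (trans (cong (suc k *_) (^-distribʳ-* k (suc v) d)) (sym (*-assoc (suc k) (suc v ^ k) (d ^ k)))) ⟩
      v * d ^ suc k + suc k * suc v ^ k * d ^ k    ≡⟨ cong (λ e → v * d ^ suc k + e * d ^ k) d≡ ⟨
      v * d ^ suc k + d ^ suc k                    ≡⟨ +-comm (v * d ^ suc k) (d ^ suc k) ⟩
      suc v * d ^ suc k                            ≤⟨ *-monoˡ-≤ (d ^ suc k) v<u ⟩
      u * d ^ suc k                                ∎))
      where
      open ≤-Reasoning
      mᵏ≤ = ≮⇒≥ nlt
      v≤vᵏ : ∀ v → v ≤ v ^ suc k
      v≤vᵏ zero = z≤n
      v≤vᵏ v@(suc _) = ≤-trans (≤-reflexive (sym (*-identityʳ v))) (*-monoʳ-≤ v (m^n>0 v k))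
      m≤vd : m ≤ v * d
      m≤vd with m ≤? v * d
      ... | yes le = le
      ... | no nle = contradiction mᵏ≤ (<⇒≱ (begin-strict
        v * d ^ suc k           ≤⟨ *-monoˡ-≤ (d ^ suc k) (v≤vᵏ v) ⟩
        v ^ suc k * d ^ suc k   ≡⟨ ^-distribʳ-* (suc k) v d ⟨
        (v * d) ^ suc k         <⟨ ^-monoˡ-< (suc k) (≰⇒> nle) ⟩
        m ^ suc k               ∎))
      m+1≤ : suc m ≤ suc v * d
      m+1≤ = +-mono-≤ 1≤d m≤vd

  -- Here u^(1/8) alone exceeds v^(1/8), and L ≥ 0 can only help. The witness is a rational t with
  -- v^(1/8) < t ≤ u^(1/8).
  <⇒Root8Gt : ∀ L {u v} → v < u → Root8Gt L u v
  <⇒Root8Gt L {u} {v} v<u =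
    let m , m⁸≤ud⁸ , vd⁸<m⁸ = rational-root-between 7 d 1≤d refl v<u
    in m , d , 1≤d , m⁸≤ud⁸ , <-≤-trans vd⁸<m⁸ (^-monoˡ-≤ 8 (m≤n+m m (L * d)))
    where
    d = 8 * suc v ^ 7
    1≤d : 1 ≤ d
    1≤d = *-mono-≤ {1} {8} (s≤s z≤n) (m^n>0 (suc v) 7)

  -- Here L alone exceeds v^(1/8), so t = 0 is a witness.
  <⁸⇒Root8Gt : ∀ L u {v} → v < L ^ 8 → Root8Gt L u v
  <⁸⇒Root8Gt L u v<L⁸ = 0 , 1 , ≤-refl , z≤n , subst₂ _<_ (sym (*-identityʳ _))
      (cong (_^ 8) (sym (trans (+-identityʳ (L * 1)) (*-identityʳ L)))) v<L⁸

  -- Since φ(n)/n ≤ Π′/Π, it is enough to show Π′ Z ≤ Π N. For this the error Π M E is raised to Π′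
  -- M² E, so that Π′ factors out and the sieve inequality reduces to the assumption on Z.
  sieve-to-count : ∀ {Π Π′ M E N n φn X Z} .{{_ : NonZero Π}} →
    Π′ * X ≤ Π * N + Π * (M * E) → φn * Π ≤ n * Π′ → Π ≤ Π′ * M → Z + M * M * E ≤ X → φn * Z ≤ N * n
  sieve-to-count {Π} {Π′} {M} {E} {N} {n} {φn} {X} {Z} sieve φ-upper Π≤ Z≤ = *-cancelˡ-≤ Π (begin
    Π * (φn * Z)      ≡⟨ reorder Π φn Z ⟩
    φn * Π * Z        ≤⟨ *-monoˡ-≤ Z φ-upper ⟩
    n * Π′ * Z        ≡⟨ *-assoc n Π′ Z ⟩
    n * (Π′ * Z)      ≤⟨ *-monoʳ-≤ n (+-cancelʳ-≤ (Π′ * M * (M * E)) (Π′ * Z) (Π * N) (begin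
      Π′ * Z + Π′ * M * (M * E)   ≡⟨ collect Π′ Z M E ⟩
      Π′ * (Z + M * M * E)        ≤⟨ *-monoʳ-≤ Π′ Z≤ ⟩
      Π′ * X                      ≤⟨ sieve ⟩
      Π * N + Π * (M * E)         ≤⟨ +-monoʳ-≤ (Π * N) (*-monoˡ-≤ (M * E) Π≤) ⟩
      Π * N + Π′ * M * (M * E)    ∎)) ⟩
    n * (Π * N)       ≡⟨ reorder′ n Π N ⟩
    Π * (N * n)       ∎)
    where
    open ≤-Reasoning
    reorder : ∀ a b c → a * (b * c) ≡ b * a * c
    reorder = ℕSolver.solve-∀
    reorder′ : ∀ a b c → a * (b * c) ≡ b * (c * a)
    reorder′ = ℕSolver.solve-∀
    collect : ∀ p z m e → p * z + p * m * (m * e) ≡ p * (z + m * m * e)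
    collect = ℕSolver.solve-∀

  module _ (Q s-1 M : ℕ) (1≤M : 1 ≤ M) (large : 2 ^ 8 * M ^ 8 * suc Q ≤ Q * Q) where
    private
      s = suc s-1
      c = 2 * M
      Y = Q ^ (s + s)
      B = M * M * (2 ^ (s + s) * suc Q ^ s)

      2≤c : 2 ≤ c
      2≤c = *-monoʳ-≤ 2 1≤M

      -- The hypothesis says c⁸ (Q + 1) ≤ Q², and Q² ≤ Q (Q + 1).
      c⁸≤Q : c ^ 8 ≤ Q
      c⁸≤Q with c ^ 8 ≤? Q
      ... | yes le = le
      ... | no nle = contradiction large (<⇒≱ (begin-strict
        Q * Q                  ≤⟨ *-monoʳ-≤ Q (n≤1+n Q) ⟩
        Q * suc Q              <⟨ *-monoˡ-< (suc Q) (≰⇒> nle) ⟩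
        c ^ 8 * suc Q          ≡⟨ cong (_* suc Q) (^-distribʳ-* 8 2 M) ⟩
        2 ^ 8 * M ^ 8 * suc Q  ∎))
        where open ≤-Reasoning

      256≤Q : 256 ≤ Q
      256≤Q = ≤-trans (^-monoˡ-≤ 8 2≤c) c⁸≤Q

      instance
        Q≢0 : NonZero Q
        Q≢0 = >-nonZero (≤-trans (s≤s z≤n) 256≤Q)
        c≢0 : NonZero c
        c≢0 = >-nonZero (≤-trans (s≤s z≤n) 2≤c)

      Q+1≤2Q : suc Q ≤ 2 * Q
      Q+1≤2Q = ≤-trans (+-monoˡ-≤ Q (≤-trans (s≤s z≤n) 256≤Q)) (≤-reflexive (cong (_+_ Q) (sym (+-identityʳ Q))))

      -- Split c⁸ as c² c⁶ and use c⁶ ≥ c³ ≥ 8.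
      8c²≤Q : c * c * 8 ≤ Q
      8c²≤Q = begin
        c * c * 2 ^ 3       ≤⟨ *-monoʳ-≤ (c * c)
            (≤-trans (^-monoˡ-≤ 3 2≤c) (^-monoʳ-≤ c {3} {6} (s≤s (s≤s (s≤s z≤n))))) ⟩
        c * c * c ^ 6       ≡⟨ *-assoc c c (c ^ 6) ⟩
        c ^ 8               ≤⟨ c⁸≤Q ⟩
        Q                   ∎
        where open ≤-Reasoning

      -- With q ≤ 2 Q the left side is at most c² 8^s Q^s. One factor 8 fits together with c² under
      -- a single Q, and each of the remaining s - 1 factors 8 fits under a Q of its own, which
      -- leaves Q^s Q^s.
      4B≤Y : 4 * B ≤ Y
      4B≤Y = begin
        4 * B                                   ≡⟨ regroup M (2 ^ (s + s)) (suc Q ^ s) ⟩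
        c * c * (2 ^ (s + s) * suc Q ^ s)       ≤⟨ *-monoʳ-≤ (c * c) (*-monoʳ-≤ (2 ^ (s + s)) (^-monoˡ-≤ s Q+1≤2Q)) ⟩
        c * c * (2 ^ (s + s) * (2 * Q) ^ s)
            ≡⟨ cong (λ u → c * c * u)
                (trans (cong₂ _*_ (trans (^-distribˡ-+-* 2 s s) (sym (^-distribʳ-* s 2 2))) (^-distribʳ-* s 2 Q))
                    (trans (sym (*-assoc (4 ^ s) (2 ^ s) (Q ^ s))) (cong (_* Q ^ s) (sym (^-distribʳ-* s 4 2))))) ⟩
        c * c * (8 ^ s * Q ^ s)                 ≡⟨ reassoc (c * c) (8 ^ s-1) (Q ^ s) ⟩
        c * c * 8 * 8 ^ s-1 * Q ^ s
            ≤⟨ *-monoˡ-≤ (Q ^ s) (*-mono-≤ 8c²≤Q (^-monoˡ-≤ s-1 (≤-trans (m≤m+n 8 248) 256≤Q))) ⟩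
        Q ^ s * Q ^ s                           ≡⟨ ^-distribˡ-+-* Q s s ⟨
        Y                                       ∎
        where
        open ≤-Reasoning
        regroup : ∀ M a b → 4 * (M * M * (a * b)) ≡ 2 * M * (2 * M) * (a * b)
        regroup = ℕSolver.solve-∀
        reassoc : ∀ a b d → a * (8 * b * d) ≡ a * 8 * b * d
        reassoc = ℕSolver.solve-∀

      4≤Y : 4 ≤ Y
      4≤Y = ≤-trans (≤-trans (m≤m+n 4 252) 256≤Q)
          (≤-trans (≤-reflexive (sym (*-identityʳ Q))) (*-monoʳ-≤ Q (m^n>0 Q (s-1 + s))))

      -- The largest value that Z + B ≤ Y - 1 permits; `B<Y` ensures that the truncated subtraction
      -- is exact.
      Z = Y ∸ suc B

      B<Y : suc B ≤ Y
      B<Y = *-cancelˡ-≤ 2 (begin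
        2 * suc B          ≤⟨ *-monoʳ-≤ 2 (s≤s (m≤m+n B B)) ⟩
        2 * (1 + (B + B))  ≡⟨ regroup B ⟩
        2 + 4 * B          ≤⟨ +-mono-≤ (≤-trans (m≤m+n 2 2) 4≤Y) 4B≤Y ⟩
        Y + Y              ≡⟨ cong (_+_ Y) (+-identityʳ Y) ⟨
        2 * Y              ∎)
        where
        open ≤-Reasoning
        regroup : ∀ B → 2 * (1 + (B + B)) ≡ 2 + 4 * B
        regroup = ℕSolver.solve-∀

      -- Both 4 and 4 B are at most Y, so removing B + 1 costs at most half of Y.
      Y≤2Z : Y ≤ 2 * Z
      Y≤2Z = *-cancelˡ-≤ 2 (+-cancelʳ-≤ (Y + Y) (2 * Y) (2 * (2 * Z)) (begin
        2 * Y + (Y + Y)            ≡⟨ regroup Y ⟩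
        4 * Y                      ≡⟨ cong (4 *_) (m∸n+n≡m B<Y) ⟨
        4 * (Z + suc B)            ≡⟨ spread Z B ⟩
        2 * (2 * Z) + (4 + 4 * B)  ≤⟨ +-monoʳ-≤ (2 * (2 * Z)) (+-mono-≤ 4≤Y 4B≤Y) ⟩
        2 * (2 * Z) + (Y + Y)      ∎))
        where
        open ≤-Reasoning
        regroup : ∀ Y → 2 * Y + (Y + Y) ≡ 4 * Y
        regroup = ℕSolver.solve-∀
        spread : ∀ Z B → 4 * (Z + suc B) ≡ 2 * (2 * Z) + (4 + 4 * B)
        spread = ℕSolver.solve-∀

    -- Half of the main term is enough. Since Z ≥ Y / 2, the eighth power of Z is at least Q^(16 s)
    -- / 2⁸, and 16 s exceeds 12 s + 2 by 4 (s - 1) + 2 ≥ 2. The surplus power of Q is at least Q²,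
    -- which pays for 2⁸ because Q ≥ 256.
    main-term : ∃ λ Z → Z + M * M * (2 ^ (s + s) * suc Q ^ s) ≤ Q ^ (s + s) ∸ 1 × Q ^ (12 * s + 2) < Z ^ 8
    main-term = Z , ≤-reflexive Z+B≡Y-1 , *-cancelˡ-< (2 ^ 8) (Q ^ (12 * s + 2)) (Z ^ 8) (begin-strict
      2 ^ 8 * Q ^ (12 * s + 2)                     <⟨ *-monoˡ-< (Q ^ (12 * s + 2)) {{m^n≢0 Q (12 * s + 2)}} 2⁸<Q^ ⟩
      Q ^ (4 * s-1 + 2) * Q ^ (12 * s + 2)         ≡⟨ ^-distribˡ-+-* Q (4 * s-1 + 2) (12 * s + 2) ⟨
      Q ^ (4 * s-1 + 2 + (12 * s + 2))             ≡⟨ cong (Q ^_) (exponent s-1) ⟩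
      Q ^ ((s + s) * 8)                            ≡⟨ ^-*-assoc Q (s + s) 8 ⟨
      Y ^ 8                                        ≤⟨ ^-monoˡ-≤ 8 Y≤2Z ⟩
      (2 * Z) ^ 8                                  ≡⟨ ^-distribʳ-* 8 2 Z ⟩
      2 ^ 8 * Z ^ 8                                ∎)
      where
      open ≤-Reasoning
      exponent : ∀ t → 4 * t + 2 + (12 * suc t + 2) ≡ (suc t + suc t) * 8
      exponent = ℕSolver.solve-∀
      2⁸<Q^ : 2 ^ 8 < Q ^ (4 * s-1 + 2)
      2⁸<Q^ = begin-strict
        2 ^ 8                        <⟨ m<m*n 256 256 (s≤s (s≤s z≤n)) ⟩
        256 * 256                    ≤⟨ *-mono-≤ 256≤Q 256≤Q ⟩
        Q * Q                        ≡⟨ cong (Q *_) (*-identityʳ Q) ⟨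
        Q ^ 2                        ≤⟨ ^-monoʳ-≤ Q (m≤n+m 2 (4 * s-1)) ⟩
        Q ^ (4 * s-1 + 2)            ∎
      Z+B≡Y-1 : Z + B ≡ Y ∸ 1
      Z+B≡Y-1 = cong pred (trans (sym (+-suc Z B)) (m∸n+n≡m B<Y))

  module _ {φn Wn M Q s-1 N n : ℕ} (1≤Q : 1 ≤ Q) (1≤φ : 1 ≤ φn) (1≤M : 1 ≤ M) (M≤W : M ≤ Wn)
    (count : ∀ {Z} → Z + M * M * (2 ^ (suc s-1 + suc s-1) * suc Q ^ suc s-1) ≤ Q ^ (suc s-1 + suc s-1) ∸ 1 → φn * Z
        ≤ N * n) where
    private
      s = suc s-1
      L = N * n
      u = 2 ^ 8 * φn ^ 8 * Wn ^ 8 * Q ^ (12 * s) * suc Q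
      v = φn ^ 8 * Q ^ (12 * s + 2)

      instance
        φⁿ≢0 : ∀ {k} → NonZero (φn ^ k)
        φⁿ≢0 {k} = m^n≢0 φn k {{>-nonZero 1≤φ}}
        Qⁿ≢0 : ∀ {k} → NonZero (Q ^ k)
        Qⁿ≢0 {k} = m^n≢0 Q k {{>-nonZero 1≤Q}}

      -- The factor φ⁸ Q^(12 s) is common to u and v. What remains is Q² < 2⁸ W⁸ q, the eighth power
      -- of (q-1)^(1/4) < 2 q^(1/8) W.
      small : ¬ 2 ^ 8 * Wn ^ 8 * suc Q ≤ Q * Q → v < u
      small ≰ = begin-strict
        φn ^ 8 * Q ^ (12 * s + 2)
            ≡⟨ cong (φn ^ 8 *_) (trans (^-distribˡ-+-* Q (12 * s) 2)
                (cong (λ u → Q ^ (12 * s) * (Q * u)) (*-identityʳ Q))) ⟩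
        φn ^ 8 * (Q ^ (12 * s) * (Q * Q))                     ≡⟨ *-assoc (φn ^ 8) (Q ^ (12 * s)) (Q * Q) ⟨
        φn ^ 8 * Q ^ (12 * s) * (Q * Q)
            <⟨ *-monoʳ-< (φn ^ 8 * Q ^ (12 * s)) {{m*n≢0 (φn ^ 8) (Q ^ (12 * s)) {{φⁿ≢0 {8}}} {{Qⁿ≢0 {12 * s}}}}}
                (≰⇒> ≰) ⟩
        φn ^ 8 * Q ^ (12 * s) * (2 ^ 8 * Wn ^ 8 * suc Q)
            ≡⟨ reorder (φn ^ 8) (Q ^ (12 * s)) (2 ^ 8) (Wn ^ 8) (suc Q) ⟩
        2 ^ 8 * φn ^ 8 * Wn ^ 8 * Q ^ (12 * s) * suc Q        ∎
        where
        open ≤-Reasoning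
        reorder : ∀ a b c d e → a * b * (c * d * e) ≡ c * a * d * b * e
        reorder = ℕSolver.solve-∀

      large⇒v<L⁸ : 2 ^ 8 * Wn ^ 8 * suc Q ≤ Q * Q → v < L ^ 8
      large⇒v<L⁸ large = let
          Z , Z≤ , X<Z⁸ = main-term Q s-1 M 1≤M
              (≤-trans (*-monoˡ-≤ (suc Q) (*-monoʳ-≤ (2 ^ 8) (^-monoˡ-≤ 8 M≤W))) large)
        in begin-strict
        φn ^ 8 * Q ^ (12 * s + 2)          <⟨ *-monoʳ-< (φn ^ 8) {{φⁿ≢0 {8}}} X<Z⁸ ⟩
        φn ^ 8 * Z ^ 8                     ≡⟨ ^-distribʳ-* 8 φn Z ⟨
        (φn * Z) ^ 8                       ≤⟨ ^-monoˡ-≤ 8 (count Z≤) ⟩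
        L ^ 8                              ∎
        where open ≤-Reasoning

    root8-conclusion : Root8Gt L u v
    root8-conclusion = conclude (2 ^ 8 * Wn ^ 8 * suc Q ≤? Q * Q)
      where
      conclude : Dec (2 ^ 8 * Wn ^ 8 * suc Q ≤ Q * Q) → Root8Gt L u v
      conclude (no ≰) = <⇒Root8Gt L (small ≰)
      conclude (yes large) = <⁸⇒Root8Gt L u (large⇒v<L⁸ large)

-- Auxiliary facts on multiple sums, squares and Boolean lists

sum-*-sum : ∀ {m} (f : Fin m → ℤ) → sum f ℤ.* sum f ≡ sum (λ y → sum (λ z → f y ℤ.* f z))
sum-*-sum f = trans (*-distribʳ-sum (sum f) f) (sum-cong-≗ (λ y → *-distribˡ-sum (f y) f))

sum-swap₄ : ∀ {m} (F : Fin m → Fin m → Fin m → Fin m → ℤ) →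
  sum (λ a → sum (λ b → sum (λ c → sum (λ d → F a b c d)))) ≡
  sum (λ c → sum (λ d → sum (λ a → sum (λ b → F a b c d))))
sum-swap₄ F = begin
  sum (λ a → sum (λ b → sum (λ c → sum (λ d → F a b c d))))
    ≡⟨ sum-cong-≗ (λ a → ∑-comm (λ b c → sum (λ d → F a b c d))) ⟩
  sum (λ a → sum (λ c → sum (λ b → sum (λ d → F a b c d))))
    ≡⟨ ∑-comm (λ a c → sum (λ b → sum (λ d → F a b c d))) ⟩
  sum (λ c → sum (λ a → sum (λ b → sum (λ d → F a b c d))))
    ≡⟨ sum-cong-≗ (λ c → sum-cong-≗ (λ a → ∑-comm (λ b d → F a b c d))) ⟩
  sum (λ c → sum (λ a → sum (λ d → sum (λ b → F a b c d))))
    ≡⟨ sum-cong-≗ (λ c → ∑-comm (λ a d → sum (λ b → F a b c d))) ⟩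
  sum (λ c → sum (λ d → sum (λ a → sum (λ b → F a b c d)))) ∎
  where open ≡-Reasoning

abs-≤-from-square : ∀ i b → i ℤ.* i ℤ.≤ + (b ℕ.* b) → ∣ i ∣ ℕ.≤ b
abs-≤-from-square i b i²≤b² with ∣ i ∣ ℕ.≤? b
... | yes ∣i∣≤b = ∣i∣≤b
... | no ∣i∣≰b = contradiction (ℤ.drop‿+≤+ (ℤ.≤-trans (ℤ.≤-reflexive (sym (square i))) i²≤b²))
    (ℕ.<⇒≱ (ℕ.*-mono-< (ℕ.≰⇒> ∣i∣≰b) (ℕ.≰⇒> ∣i∣≰b)))
  where
  square : ∀ i → i ℤ.* i ≡ + (∣ i ∣ ℕ.* ∣ i ∣)
  square (+ m) = sym (ℤ.pos-* m m)
  square -[1+ m ] = refl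

all-∈ : ∀ {A : Set} (f : A → Bool) {xs} → all f xs ≡ true → ∀ {x} → x ∈ xs → f x ≡ true
all-∈ f {x ∷ xs} h (here refl) with f x
... | true = refl
all-∈ f {y ∷ xs} h (there x∈) with f y
... | true = all-∈ f h x∈

all-tabulate : ∀ {A : Set} (f : A → Bool) {m} (xs : Fin m → A) → (∀ i → f (xs i) ≡ true) → all f (tabulate xs) ≡ true
all-tabulate f {zero} xs h = refl
all-tabulate f {suc m} xs h rewrite h zero = all-tabulate f (xs ∘ suc) (h ∘ suc)

all-tabulate⁻ : ∀ {A : Set} (f : A → Bool) {m} (xs : Fin m → A) → all f (tabulate xs) ≡ true → ∀ i → f (xs i) ≡ true
all-tabulate⁻ f {suc m} xs h zero with f (xs zero)
... | true = refl
all-tabulate⁻ f {suc m} xs h (suc i) with f (xs zero)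
... | true = all-tabulate⁻ f (xs ∘ suc) h i

∧-true⁻ : ∀ {a b} → a ∧ b ≡ true → a ≡ true × b ≡ true
∧-true⁻ {true} h = refl , h

funToFin-cong : ∀ {m k} {f g : Fin m → Fin k} → (∀ i → f i ≡ g i) → funToFin f ≡ funToFin g
funToFin-cong {zero} _ = refl
funToFin-cong {suc m} f≗g = cong₂ Fin.combine (f≗g zero) (funToFin-cong (f≗g ∘ suc))

-- The multiplicative group of a finite field

module FieldOnFin (n : ℕ) .{{_ : ℕ.NonZero n}}
  {add mul : Op₂ (Fin (suc n))} {neg : Op₁ (Fin (suc n))} {0# 1# : Fin (suc n)}
  (isCommutativeRing : IsCommutativeRing _≡_ add mul neg 0# 1#)
  (1≢0 : 1# ≢ 0#)
  (inverse : ∀ x → x ≢ 0# → ∃ λ y → mul x y ≡ 1#) where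

  K : Set
  K = Fin (suc n)

  K-ring : CommutativeRing 0ℓ 0ℓ
  K-ring = record { isCommutativeRing = isCommutativeRing }

  open CommutativeRing K-ring using (_+_; _*_; -_; +-assoc; +-comm; +-identityˡ; +-identityʳ; -‿inverseˡ; -‿inverseʳ;
    *-assoc; *-comm; *-identityˡ; *-identityʳ; zeroˡ; zeroʳ; distribˡ; *-commutativeMonoid; commutativeSemiring)
  open Exp commutativeSemiring using (_^_; ^-homo-*; ^-assocʳ; ^-distrib-*)
  open MonoidSum *-commutativeMonoid using () renaming
      (sum to prod; sum-cong-≗ to prod-cong; ∑-distrib-+ to prod-*; sum-permute to prod-permute; sum-remove to
          prod-remove; sum-replicate to prod-replicate)

  open SemiringSolver commutativeSemiring using (solve; _:=_; _:+_; _:*_)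

  *-cancelˡ : ∀ {x y z} → x ≢ 0# → x * y ≡ x * z → y ≡ z
  *-cancelˡ {x} {y} {z} x≢0 xy≡xz with inverse x x≢0
  ... | x⁻¹ , xx⁻¹≡1 = begin
    y               ≡⟨ undo y ⟨
    x⁻¹ * (x * y)   ≡⟨ cong (x⁻¹ *_) xy≡xz ⟩
    x⁻¹ * (x * z)   ≡⟨ undo z ⟩
    z               ∎
    where
    open ≡-Reasoning
    undo : ∀ u → x⁻¹ * (x * u) ≡ u
    undo u = trans (sym (*-assoc x⁻¹ x u)) (trans (cong (_* u) (trans (*-comm x⁻¹ x) xx⁻¹≡1)) (*-identityˡ u))

  *-nonzero : ∀ {x y} → x ≢ 0# → y ≢ 0# → x * y ≢ 0#
  *-nonzero x≢0 y≢0 xy≡0 = y≢0 (*-cancelˡ x≢0 (trans xy≡0 (sym (zeroʳ _))))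

  ^-nonzero : ∀ {x} k → x ≢ 0# → x ^ k ≢ 0#
  ^-nonzero zero x≢0 = 1≢0
  ^-nonzero (suc k) x≢0 = *-nonzero x≢0 (^-nonzero k x≢0)

  0^suc : ∀ k .{{_ : ℕ.NonZero k}} → 0# ^ k ≡ 0#
  0^suc (suc k) = zeroˡ _

  1^ : ∀ k → 1# ^ k ≡ 1#
  1^ zero = refl
  1^ (suc k) = trans (*-identityˡ _) (1^ k)

  x+-y≡0⇒x≡y : ∀ {x y} → x + - y ≡ 0# → x ≡ y
  x+-y≡0⇒x≡y {x} {y} eq = begin
    x               ≡⟨ +-identityʳ x ⟨
    x + 0#          ≡⟨ cong (_+_ x) (-‿inverseˡ y) ⟨
    x + (- y + y)   ≡⟨ +-assoc x (- y) y ⟨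
    x + - y + y     ≡⟨ cong (_+ y) eq ⟩
    0# + y          ≡⟨ +-identityˡ y ⟩
    y               ∎
    where open ≡-Reasoning

  nonzero : K → Bool
  nonzero x = not (x == 0#)

  nonzero⁻ : ∀ {x} → nonzero x ≡ true → x ≢ 0#
  nonzero⁻ {x} h with x Fin.≟ 0#
  ... | no x≢0 = x≢0
  ... | yes _ = contradiction h λ ()

  nonzero⁺ : ∀ {x} → x ≢ 0# → nonzero x ≡ true
  nonzero⁺ x≢0 = cong not (does⁺-no (_ Fin.≟ 0#) x≢0)

  sum-nonzero : sum (λ x → ⟦ nonzero x ⟧) ≡ + n
  sum-nonzero = begin
    sum (λ x → ⟦ nonzero x ⟧)              ≡⟨ sum-cong-≗ (λ x → ⟦not⟧ (x == 0#)) ⟩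
    sum (λ x → 1ℤ ℤ.- ⟦ x == 0# ⟧)         ≡⟨ sum-distrib-- (λ x → 1ℤ) (λ x → ⟦ x == 0# ⟧) ⟩
    sum {suc n} (λ x → 1ℤ) ℤ.- sum (λ x → ⟦ x == 0# ⟧)
        ≡⟨ cong₂ ℤ._-_ (trans (sum-const (suc n) 1ℤ) (ℤ.*-identityʳ (+ suc n))) (sum-== 0#) ⟩
    + suc n ℤ.- 1ℤ                         ≡⟨⟩
    + n                                    ∎
    where open ≡-Reasoning

  -- Polynomials are kept as functions built by Horner steps, so the degree is an index and no
  -- coefficient list is needed. Root counting uses only the values.
  data Monic : ℕ → (K → K) → Set where
    unit : ∀ {f} → (∀ x → f x ≡ 1#) → Monic 0 f
    horner : ∀ {d f g} → Monic d g → ∀ c → (∀ x → f x ≡ x * g x + c) → Monic (suc d) f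

  absorb : ∀ {y} a u → y + (- a + a) * u ≡ y
  absorb a u = trans (cong (_+_ _) (trans (cong (_* u) (-‿inverseˡ a)) (zeroˡ u))) (+-identityʳ _)

  -- Synthetic division: if f = x g + c and g = (x - a) k + g(a), then the quotient of f is x k +
  -- g(a), which is again in Horner form.
  monic-divide : ∀ {d f} → Monic (suc d) f → ∀ a →
                 ∃ λ g → Monic d g × (∀ x → f x ≡ (x + - a) * g x + f a)
  monic-divide (horner {f = f} {g} (unit g≡1) c f≡) a = g , unit g≡1 , λ x → begin
    f x                              ≡⟨ f≡ x ⟩
    x * g x + c                      ≡⟨ split x a (g x) c ⟩
    (x + - a) * g x + (a * g x + c)  ≡⟨ cong (λ u → (x + - a) * g x + (a * u + c)) (trans (g≡1 x) (sym (g≡1 a))) ⟩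
    (x + - a) * g x + (a * g a + c)  ≡⟨ cong (_+_ ((x + - a) * g x)) (f≡ a) ⟨
    (x + - a) * g x + f a            ∎
    where
    open ≡-Reasoning
    split : ∀ x a u c → x * u + c ≡ (x + - a) * u + (a * u + c)
    split x a u c = sym (trans
      (solve 5 (λ x a b u c → (x :+ b) :* u :+ (a :* u :+ c) := x :* u :+ c :+ (b :+ a) :* u) refl x a (- a) u c)
      (absorb a u))
  monic-divide (horner {f = f} {g} g-monic@(horner _ _ _) c f≡) a with monic-divide g-monic a
  ... | k , k-monic , g≡ = (λ x → x * k x + g a) , horner k-monic (g a) (λ _ → refl) , λ x → begin
    f x                                              ≡⟨ f≡ x ⟩
    x * g x + c                                      ≡⟨ cong (λ u → x * u + c) (g≡ x) ⟩
    x * ((x + - a) * k x + g a) + c                  ≡⟨ split x a (k x) (g a) c ⟩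
    (x + - a) * (x * k x + g a) + (a * g a + c)      ≡⟨ cong (_+_ ((x + - a) * (x * k x + g a))) (f≡ a) ⟨
    (x + - a) * (x * k x + g a) + f a                ∎
    where
    open ≡-Reasoning
    split : ∀ x a u v c → x * ((x + - a) * u + v) + c ≡ (x + - a) * (x * u + v) + (a * v + c)
    split x a u v c = sym (trans
      (solve 6 (λ x a b u v c → (x :+ b) :* (x :* u :+ v) :+ (a :* v :+ c) := x :* ((x :+ b) :* u :+ v) :+ c :+
          (b :+ a) :* v) refl x a (- a) u v c)
      (absorb a v))

  monic-roots : ∀ {d f} → Monic d f → sum (λ x → ⟦ f x == 0# ⟧) ℤ.≤ + d
  monic-roots (unit {f} f≡1) = ℤ.≤-reflexive
      (sum-0 {suc n} λ x → cong ⟦_⟧ (does⁺-no (f x Fin.≟ 0#) (λ fx≡0 → 1≢0 (trans (sym (f≡1 x)) fx≡0))))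
  monic-roots {suc d} {f} f-monic@(horner _ _ _) with Fin.any? (λ x → f x Fin.≟ 0#)
  ... | no ∄ = ℤ.≤-trans (ℤ.≤-reflexive
      (sum-0 {suc n} λ x → cong ⟦_⟧ (does⁺-no (f x Fin.≟ 0#) (λ fx≡0 → ∄ (x , fx≡0))))) (+≤+ ℕ.z≤n)
  ... | yes (a , fa≡0) with monic-divide f-monic a
  ...   | g , g-monic , f≡ = begin
    sum (λ x → ⟦ f x == 0# ⟧)                   ≤⟨ sum-mono root ⟩
    sum (λ x → ⟦ x == a ⟧ ℤ.+ ⟦ g x == 0# ⟧)    ≡⟨ ∑-distrib-+ (λ x → ⟦ x == a ⟧) (λ x → ⟦ g x == 0# ⟧) ⟩
    sum (λ x → ⟦ x == a ⟧) ℤ.+ sum (λ x → ⟦ g x == 0# ⟧)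
        ≤⟨ ℤ.+-mono-≤ (ℤ.≤-reflexive (sum-== a)) (monic-roots g-monic) ⟩
    1ℤ ℤ.+ + d                                  ∎
    where
    open ℤ.≤-Reasoning
    root : ∀ x → ⟦ f x == 0# ⟧ ℤ.≤ ⟦ x == a ⟧ ℤ.+ ⟦ g x == 0# ⟧
    root x with x Fin.≟ a
    ... | yes _ = ℤ.≤-trans (⟦⟧-≤1 _) (ℤ.+-monoʳ-≤ 1ℤ (⟦⟧-nonneg (g x == 0#)))
    ... | no x≢a = ℤ.≤-trans (⟦⟧-mono λ h → does⁺ (g x Fin.≟ 0#) (gx≡0 (does⁻ (f x Fin.≟ 0#) h)))
        (ℤ.≤-reflexive (sym (ℤ.+-identityˡ _)))
      where
      gx≡0 : f x ≡ 0# → g x ≡ 0#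
      gx≡0 fx≡0 = *-cancelˡ (x≢a ∘ x+-y≡0⇒x≡y)
          (trans (sym (trans (f≡ x) (trans (cong (_+_ ((x + - a) * g x)) fa≡0) (+-identityʳ _))))
              (trans fx≡0 (sym (zeroʳ _))))

  ^-roots : ∀ k .{{_ : ℕ.NonZero k}} c → sum (λ x → ⟦ x ^ k == c ⟧) ℤ.≤ + k
  ^-roots (suc k) c = ℤ.≤-trans
    (sum-mono (λ x → ⟦⟧-mono λ h → does⁺ (_ Fin.≟ 0#)
        (trans (cong (_+ - c) (does⁻ (x ^ suc k Fin.≟ c) h)) (-‿inverseʳ c))))
    (monic-roots (horner {f = λ x → x ^ suc k + - c} (^-monic k) (- c) (λ _ → refl)))
    where
    ^-monic : ∀ k → Monic k (_^ k)
    ^-monic zero = unit (λ _ → refl)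
    ^-monic (suc k) = horner (^-monic k) 0# (λ x → sym (+-identityʳ _))

  prod-nonzero : ∀ {m} (f : Fin m → K) → (∀ i → f i ≢ 0#) → prod f ≢ 0#
  prod-nonzero {zero} f f≢0 = 1≢0
  prod-nonzero {suc m} f f≢0 = *-nonzero (f≢0 zero) (prod-nonzero (f ∘ suc) (f≢0 ∘ suc))

  -- Multiplication by x permutes the nonzero elements, so their product equals x^n times itself.
  -- The products run over all of K, and `units` and `scale` let 0 contribute the factor 1.
  fermat : ∀ {x} → x ≢ 0# → x ^ n ≡ 1#
  fermat {x} x≢0 with inverse x x≢0
  ... | x⁻¹ , xx⁻¹≡1 = *-cancelˡ (prod-nonzero units units≢0) (begin
    prod units * x ^ n                 ≡⟨ *-comm _ _ ⟩
    x ^ n * prod units                 ≡⟨ cong (_* prod units) prod-scale ⟨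
    prod scale * prod units            ≡⟨ prod-* scale units ⟨
    prod (λ y → scale y * units y)     ≡⟨ prod-cong scale-units ⟨
    prod (λ y → units (x * y))
        ≡⟨ prod-permute units (permutation (x *_) (x⁻¹ *_) (λ y → back y) (λ y → forth y)) ⟨
    prod units                         ≡⟨ *-identityʳ _ ⟨
    prod units * 1#                    ∎)
    where
    open ≡-Reasoning
    back : ∀ y → x * (x⁻¹ * y) ≡ y
    back y = trans (sym (*-assoc x x⁻¹ y)) (trans (cong (_* y) xx⁻¹≡1) (*-identityˡ y))
    forth : ∀ y → x⁻¹ * (x * y) ≡ y
    forth y = trans (sym (*-assoc x⁻¹ x y)) (trans (cong (_* y) (trans (*-comm x⁻¹ x) xx⁻¹≡1)) (*-identityˡ y))
    units scale : K → K
    units y = if y == 0# then 1# else y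
    scale y = if y == 0# then 1# else x
    units≢0 : ∀ y → units y ≢ 0#
    units≢0 y with y Fin.≟ 0#
    ... | yes _ = 1≢0
    ... | no y≢0 = y≢0
    scale-units : ∀ y → units (x * y) ≡ scale y * units y
    scale-units y with y Fin.≟ 0#
    ... | yes refl = trans (cong (λ b → if b then 1# else x * 0#) (does⁺ (x * 0# Fin.≟ 0#) (zeroʳ x)))
        (sym (*-identityˡ 1#))
    ... | no y≢0 = cong (λ b → if b then 1# else x * y) (does⁺-no (x * y Fin.≟ 0#) (*-nonzero x≢0 y≢0))
    prod-scale : prod scale ≡ x ^ n
    prod-scale = begin
      prod scale                          ≡⟨ prod-remove {i = 0#} scale ⟩
      scale 0# * prod (scale ∘ Fin.punchIn 0#)
          ≡⟨ cong₂ _*_ (cong (λ b → if b then 1# else x) (does⁺ (0# Fin.≟ 0#) refl))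
          (prod-cong {n} (λ i → cong (λ b → if b then 1# else x)
              (does⁺-no (Fin.punchIn 0# i Fin.≟ 0#) (Fin.punchInᵢ≢i 0# i)))) ⟩
      1# * prod {n} (λ _ → x)             ≡⟨ *-identityˡ _ ⟩
      prod {n} (λ _ → x)                  ≡⟨ prod-replicate n ⟩
      x ^ n                               ∎

  -- Orders of elements and the subgroups of d-th powers

  ^-multiple : ∀ {x m} c → x ^ m ≡ 1# → x ^ (c ℕ.* m) ≡ 1#
  ^-multiple {x} {m} c xᵐ≡1 = trans (cong (x ^_) (ℕ.*-comm c m))
      (trans (sym (^-assocʳ x m c)) (trans (cong (_^ c) xᵐ≡1) (1^ c)))

  ^-difference : ∀ {x d i} j → d ℕ.+ j ≡ i → x ^ i ≡ 1# → x ^ j ≡ 1# → x ^ d ≡ 1#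
  ^-difference {x} {d} j refl p q = trans (sym (*-identityʳ _))
      (trans (cong (x ^ d *_) (sym q)) (trans (sym (^-homo-* x d j)) p))

  -- Over ℕ the Bézout identity presents the gcd as a difference of multiples in one of two orders,
  -- hence the two cases.
  ^-gcd : ∀ {x} a b → x ^ a ≡ 1# → x ^ b ≡ 1# → x ^ gcd a b ≡ 1#
  ^-gcd {x} a b xᵃ≡1 xᵇ≡1 with Bézout.identity (gcd-GCD a b)
  ... | Bézout.+- u v eq = ^-difference (v ℕ.* b) eq (^-multiple u xᵃ≡1) (^-multiple v xᵇ≡1)
  ... | Bézout.-+ u v eq = ^-difference (u ℕ.* a) eq (^-multiple v xᵇ≡1) (^-multiple u xᵃ≡1)

  -- For d ∣ n this is the indicator of the subgroup of d-th powers of Kˣ.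
  power : ℕ → K → Bool
  power zero x = false
  power (suc d) x = x ^ (n ℕ./ suc d) == 1#

  power-∣ : ∀ d k → n ≡ k ℕ.* d → ∀ x → power d x ≡ (x ^ k == 1#)
  power-∣ zero k n≡ x = contradiction (trans n≡ (ℕ.*-zeroʳ k)) (ℕ.≢-nonZero⁻¹ n)
  power-∣ (suc d) k n≡ x = cong (λ j → x ^ j == 1#) (trans (cong (ℕ._/ suc d) n≡) (m*n/n≡m k (suc d)))

  cofactor-nonZero : ∀ {d k} → n ≡ k ℕ.* d → ℕ.NonZero k
  cofactor-nonZero {d} {k} n≡ = ℕ.≢-nonZero λ { refl → ℕ.≢-nonZero⁻¹ n n≡ }

  divisor-nonZero : ∀ {d k} → n ≡ k ℕ.* d → ℕ.NonZero d
  divisor-nonZero {d} {k} n≡ = ℕ.≢-nonZero λ { refl → ℕ.≢-nonZero⁻¹ n (trans n≡ (ℕ.*-zeroʳ k)) }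

  power⇒nonzero : ∀ {d} → d ∣ n → ∀ {x} → power d x ≡ true → x ≢ 0#
  power⇒nonzero {d} (divides k n≡) {x} h refl = 1≢0
      (trans (sym (does⁻ (0# ^ k Fin.≟ 1#) (trans (sym (power-∣ d k n≡ 0#)) h))) (0^suc k {{cofactor-nonZero n≡}}))

  power-1 : ∀ x → power 1 x ≡ nonzero x
  power-1 x = bool-iff (λ h → nonzero⁺ (power⇒nonzero (1∣ n) h))
    (λ h → trans (power-∣ 1 n (sym (ℕ.*-identityʳ n)) x) (does⁺ (x ^ n Fin.≟ 1#) (fermat (nonzero⁻ h))))

  power-*-invariant : ∀ {d} → d ∣ n → ∀ {y} → power d y ≡ true → ∀ x → power d (y * x) ≡ power d x
  power-*-invariant {d} (divides k n≡) {y} h x = begin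
    power d (y * x)    ≡⟨ power-∣ d k n≡ (y * x) ⟩
    (y * x) ^ k == 1#  ≡⟨ cong (_== 1#)
        (trans (^-distrib-* y x k)
            (trans (cong (_* x ^ k) (does⁻ (y ^ k Fin.≟ 1#) (trans (sym (power-∣ d k n≡ y)) h))) (*-identityˡ _))) ⟩
    x ^ k == 1#        ≡⟨ power-∣ d k n≡ x ⟨
    power d x          ∎
    where open ≡-Reasoning

  -- With n = k e p, being an e-th and a p-th power reads x^(kp) = 1 and x^(ke) = 1. The order of
  -- x^k then divides both p and e, which are coprime, so x^k = 1.
  power-* : ∀ {e p} → Prime p → ¬ p ∣ e → e ℕ.* p ∣ n → ∀ x → power (e ℕ.* p) x ≡ power e x ∧ power p x
  power-* {e} {p} p-prime p∤e (divides k n≡) x = begin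
    power (e ℕ.* p) x                                ≡⟨ power-∣ (e ℕ.* p) k n≡ x ⟩
    x ^ k == 1#                                      ≡⟨ bool-iff to from ⟩
    (x ^ (k ℕ.* p) == 1#) ∧ (x ^ (k ℕ.* e) == 1#)
        ≡⟨ cong₂ _∧_ (power-∣ e (k ℕ.* p) n≡e x) (power-∣ p (k ℕ.* e) n≡p x) ⟨
    power e x ∧ power p x                            ∎
    where
    open ≡-Reasoning
    n≡p : n ≡ k ℕ.* e ℕ.* p
    n≡p = trans n≡ (sym (ℕ.*-assoc k e p))
    n≡e : n ≡ k ℕ.* p ℕ.* e
    n≡e = trans n≡ (trans (cong (k ℕ.*_) (ℕ.*-comm e p)) (sym (ℕ.*-assoc k p e)))
    to : (x ^ k == 1#) ≡ true → (x ^ (k ℕ.* p) == 1#) ∧ (x ^ (k ℕ.* e) == 1#) ≡ true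
    to h = cong₂ _∧_ (does⁺ (x ^ (k ℕ.* p) Fin.≟ 1#) (raise p)) (does⁺ (x ^ (k ℕ.* e) Fin.≟ 1#) (raise e))
      where
      raise : ∀ c → x ^ (k ℕ.* c) ≡ 1#
      raise c = trans (cong (x ^_) (ℕ.*-comm k c)) (^-multiple c (does⁻ (x ^ k Fin.≟ 1#) h))
    from : (x ^ (k ℕ.* p) == 1#) ∧ (x ^ (k ℕ.* e) == 1#) ≡ true → (x ^ k == 1#) ≡ true
    from h with x ^ (k ℕ.* p) Fin.≟ 1# | x ^ (k ℕ.* e) Fin.≟ 1#
    ... | yes xᵏᵖ≡1 | yes xᵏᵉ≡1 = does⁺ (x ^ k Fin.≟ 1#) (trans (sym (*-identityʳ _))
      (trans (cong ((x ^ k) ^_) (sym (coprime⇒gcd≡1 (prime∤⇒coprime p-prime p∤e))))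
        (^-gcd e p (trans (^-assocʳ x k e) xᵏᵉ≡1) (trans (^-assocʳ x k p) xᵏᵖ≡1))))
    ... | yes _ | no _ = contradiction h λ ()
    ... | no _ | _ = contradiction h λ ()

  -- The roots of x^(n/d) = 1 bound the subgroup from above, the fibres of x ↦ x^d from below.
  sum-power : ∀ {d} → d ∣ n → + d ℤ.* sum (λ x → ⟦ power d x ⟧) ≡ + n
  sum-power {d} (divides k n≡) = ℤ.≤-antisym upper lower
    where
    open ℤ.≤-Reasoning
    H : K → Bool
    H x = x ^ k == 1#
    upper : + d ℤ.* sum (λ x → ⟦ power d x ⟧) ℤ.≤ + n
    upper = begin
      + d ℤ.* sum (λ x → ⟦ power d x ⟧) ≡⟨ cong (+ d ℤ.*_) (sum-cong-≗ (λ x → cong ⟦_⟧ (power-∣ d k n≡ x))) ⟩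
      + d ℤ.* sum (λ x → ⟦ H x ⟧)
          ≤⟨ *-monoˡ-nonneg {k = + d} (+≤+ ℕ.z≤n) (^-roots k {{cofactor-nonZero n≡}} 1#) ⟩
      + d ℤ.* + k                       ≡⟨ ℤ.pos-* d k ⟨
      + (d ℕ.* k)                       ≡⟨ cong +_ (trans (ℕ.*-comm d k) (sym n≡)) ⟩
      + n                               ∎
    covered : ∀ x → ⟦ nonzero x ⟧ ℤ.≤ sum (λ y → ⟦ H y ⟧ ℤ.* ⟦ x ^ d == y ⟧)
    covered x with nonzero x in x≢0
    ... | false = sum-nonneg (λ y → *-nonneg (⟦⟧-nonneg (H y)) (⟦⟧-nonneg (x ^ d == y)))
    ... | true = begin
      1ℤ                                      ≡⟨ cong₂ (λ a b → ⟦ a ⟧ ℤ.* ⟦ b ⟧)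
          (does⁺ ((x ^ d) ^ k Fin.≟ 1#)
              (trans (^-assocʳ x d k) (trans (cong (x ^_) (trans (ℕ.*-comm d k) (sym n≡))) (fermat (nonzero⁻ x≢0)))))
          (does⁺ (x ^ d Fin.≟ x ^ d) refl) ⟨
      ⟦ H (x ^ d) ⟧ ℤ.* ⟦ x ^ d == x ^ d ⟧
          ≤⟨ term≤sum (λ y → ⟦ H y ⟧ ℤ.* ⟦ x ^ d == y ⟧) (λ y → *-nonneg (⟦⟧-nonneg (H y)) (⟦⟧-nonneg (x ^ d == y)))
              (x ^ d) ⟩
      sum (λ y → ⟦ H y ⟧ ℤ.* ⟦ x ^ d == y ⟧)  ∎
    lower : + n ℤ.≤ + d ℤ.* sum (λ x → ⟦ power d x ⟧)
    lower = begin
      + n                                                    ≡⟨ sum-nonzero ⟨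
      sum (λ x → ⟦ nonzero x ⟧)                              ≤⟨ sum-mono covered ⟩
      sum (λ x → sum (λ y → ⟦ H y ⟧ ℤ.* ⟦ x ^ d == y ⟧))     ≡⟨ ∑-comm (λ x y → ⟦ H y ⟧ ℤ.* ⟦ x ^ d == y ⟧) ⟩
      sum (λ y → sum (λ x → ⟦ H y ⟧ ℤ.* ⟦ x ^ d == y ⟧))
          ≡⟨ sum-cong-≗ (λ y → *-distribˡ-sum ⟦ H y ⟧ (λ x → ⟦ x ^ d == y ⟧)) ⟨
      sum (λ y → ⟦ H y ⟧ ℤ.* sum (λ x → ⟦ x ^ d == y ⟧))
          ≤⟨ sum-mono (λ y → *-monoˡ-nonneg (⟦⟧-nonneg (H y)) (^-roots d {{divisor-nonZero {d} {k} n≡}} y)) ⟩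
      sum (λ y → ⟦ H y ⟧ ℤ.* + d)                            ≡⟨ *-distribʳ-sum (+ d) (λ y → ⟦ H y ⟧) ⟨
      sum (λ y → ⟦ H y ⟧) ℤ.* + d                            ≡⟨ ℤ.*-comm _ (+ d) ⟩
      + d ℤ.* sum (λ x → ⟦ H x ⟧)
          ≡⟨ cong (+ d ℤ.*_) (sum-cong-≗ (λ x → cong ⟦_⟧ (power-∣ d k n≡ x))) ⟨
      + d ℤ.* sum (λ x → ⟦ power d x ⟧)                      ∎

  -- If x^m = 1 with 0 < m < n, then x^g = 1 for g = gcd(m, n), a proper divisor of n. A prime p
  -- dividing n/g gives x^(n/p) = 1, so x would be a p-th power. Hence the order of x is n.
  generates : ∀ {x} → x ≢ 0# → (∀ {p} → Prime p → p ∣ n → power p x ≡ false) →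
              ∀ y → y ≢ 0# → ∃ λ k → x ^ k ≡ y
  generates {x} x≢0 ¬power y y≢0 = collision (Fin.pigeonhole (ℕ.n<1+n (suc n)) f)
    where
    order : ∀ m → 1 ℕ.≤ m → m ℕ.< n → x ^ m ≢ 1#
    order m 1≤m m<n xᵐ≡1 with gcd[m,n]∣n m n
    ... | divides t n≡tg with t
    ...   | 0 = ℕ.≢-nonZero⁻¹ n n≡tg
    ...   | 1 = ℕ.<⇒≱ m<n (ℕ.≤-trans (ℕ.≤-reflexive (trans n≡tg (ℕ.*-identityˡ _)))
        (∣⇒≤ {{ℕ.>-nonZero 1≤m}} (gcd[m,n]∣m m n)))
    ...   | t@(suc (suc _)) with ∃-prime-divisor t (ℕ.s≤s (ℕ.s≤s ℕ.z≤n))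
    ...     | p , p-prime , divides u t≡ = contradiction
        (trans (sym (¬power p-prime (divides (u ℕ.* gcd m n) n≡)))
            (trans (power-∣ p (u ℕ.* gcd m n) n≡ x) (does⁺ (x ^ (u ℕ.* gcd m n) Fin.≟ 1#)
                (^-multiple u (^-gcd m n xᵐ≡1 (fermat x≢0)))))) λ ()
      where
      swap : ∀ u p g → u ℕ.* p ℕ.* g ≡ u ℕ.* g ℕ.* p
      swap = ℕSolver.solve-∀
      n≡ : n ≡ u ℕ.* gcd m n ℕ.* p
      n≡ = trans n≡tg (trans (cong (ℕ._* gcd m n) t≡) (swap u p (gcd m n)))
    -- These are n + 2 values, namely 0, y and the n powers of x, in a set of n + 1 elements. Since
    -- 0 differs from the others and the powers are distinct, the collision must be between y and a
    -- power.
    f : Fin (suc (suc n)) → K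
    f zero = 0#
    f (suc zero) = y
    f (suc (suc i)) = x ^ toℕ i
    collision : (∃ λ i → ∃ λ j → i Fin.< j × f i ≡ f j) → ∃ λ k → x ^ k ≡ y
    collision (zero , suc zero , _ , 0≡y) = contradiction (sym 0≡y) y≢0
    collision (zero , suc (suc j) , _ , 0≡xʲ) = contradiction (sym 0≡xʲ) (^-nonzero (toℕ j) x≢0)
    collision (suc zero , suc (suc j) , _ , y≡xʲ) = toℕ j , sym y≡xʲ
    collision (suc zero , suc zero , ℕ.s≤s () , _)
    collision (suc (suc i) , suc (suc j) , ℕ.s≤s (ℕ.s≤s i<j) , xⁱ≡xʲ) =
      contradiction x^diff≡1 (order (toℕ j ℕ.∸ toℕ i) (ℕ.m<n⇒0<n∸m i<j)
          (ℕ.≤-<-trans (ℕ.m∸n≤m (toℕ j) (toℕ i)) (Fin.toℕ<n j)))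
      where
      x^diff≡1 : x ^ (toℕ j ℕ.∸ toℕ i) ≡ 1#
      x^diff≡1 = *-cancelˡ (^-nonzero (toℕ i) x≢0) (trans (sym (^-homo-* x (toℕ i) _))
        (trans (cong (x ^_) (ℕ.m+[n∸m]≡n (ℕ.<⇒≤ i<j))) (trans (sym xⁱ≡xʲ) (sym (*-identityʳ _)))))

  -+-cancel : ∀ x y → - x + (x + y) ≡ y
  -+-cancel x y = trans (sym (+-assoc (- x) x y)) (trans (cong (_+ y) (-‿inverseˡ x)) (+-identityˡ y))

  +--cancel : ∀ x y → x + (- x + y) ≡ y
  +--cancel x y = trans (sym (+-assoc x (- x) y)) (trans (cong (_+ y) (-‿inverseʳ x)) (+-identityˡ y))

  untranslate : ∀ y t v → y + t + (- (t + v) + v) ≡ y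
  untranslate y t v = begin
    y + t + (- (t + v) + v)      ≡⟨ +-assoc y t _ ⟩
    y + (t + (- (t + v) + v))    ≡⟨ cong (_+_ y) (+-comm t _) ⟩
    y + (- (t + v) + v + t)      ≡⟨ cong (_+_ y) (+-assoc (- (t + v)) v t) ⟩
    y + (- (t + v) + (v + t))    ≡⟨ cong (λ u → y + (- (t + v) + u)) (+-comm v t) ⟩
    y + (- (t + v) + (t + v))    ≡⟨ cong (_+_ y) (-‿inverseˡ (t + v)) ⟩
    y + 0#                       ≡⟨ +-identityʳ y ⟩
    y                            ∎
    where open ≡-Reasoning

  sum-translateˡ : ∀ (F : K → ℤ) a → sum (λ x → F (a + x)) ≡ sum F
  sum-translateˡ F a = sum-bijection F (_+_ a) (_+_ (- a)) (+--cancel a) (-+-cancel a)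

  sum-translateʳ : ∀ (F : K → ℤ) a → sum (λ x → F (x + a)) ≡ sum F
  sum-translateʳ F a = trans (sum-cong-≗ (λ x → cong F (+-comm x a))) (sum-translateˡ F a)

  sum-scale : ∀ (F : K → ℤ) {a} → a ≢ 0# → sum (λ x → F (a * x)) ≡ sum F
  sum-scale F {a} a≢0 with inverse a a≢0
  ... | a⁻¹ , aa⁻¹≡1 = sum-bijection F (a *_) (a⁻¹ *_) (undo aa⁻¹≡1) (undo (trans (*-comm a⁻¹ a) aa⁻¹≡1))
    where
    undo : ∀ {b c} → b * c ≡ 1# → ∀ x → b * (c * x) ≡ x
    undo {b} {c} bc≡1 x = trans (sym (*-assoc b c x)) (trans (cong (_* x) bc≡1) (*-identityˡ x))

  -- Second moments over affine subsets

  -- Closure under x - y + z characterises the cosets of additive subgroups together with the empty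
  -- set. Admitting the empty set makes the notion stable under intersection without a case
  -- distinction.
  record IsAffine (V : K → Bool) : Set where
    constructor affine
    field closed : ∀ {x y z} → V x ≡ true → V y ≡ true → V z ≡ true → V (x + (- y + z)) ≡ true
  open IsAffine

  ∩-affine : ∀ {U V} → IsAffine U → IsAffine V → IsAffine (λ x → U x ∧ V x)
  ∩-affine {U} {V} aff-U aff-V = affine λ {x} {y} {z} hx hy hz →
    cong₂ _∧_ (closed aff-U (left hx) (left hy) (left hz)) (closed aff-V (right hx) (right hy) (right hz))
    where
    left : ∀ {a b} → a ∧ b ≡ true → a ≡ true
    left {true} _ = refl
    right : ∀ {a b} → a ∧ b ≡ true → b ≡ true
    right {true} h = h

  module SecondMoment (g : K → ℤ) (g-0 : g 0# ≡ 0ℤ) (sum-g : sum g ≡ 0ℤ) where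

    ‖g‖² : ℤ
    ‖g‖² = sum (λ x → g x ℤ.* g x)

    autocorrelation : K → ℤ
    autocorrelation δ = sum (λ t → g t ℤ.* g (t + δ))

    autocorrelation-0 : autocorrelation 0# ≡ ‖g‖²
    autocorrelation-0 = sum-cong-≗ (λ t → cong (λ u → g t ℤ.* g u) (+-identityʳ t))

    sum-autocorrelation : sum autocorrelation ≡ 0ℤ
    sum-autocorrelation = begin
      sum (λ δ → sum (λ t → g t ℤ.* g (t + δ)))  ≡⟨ ∑-comm (λ δ t → g t ℤ.* g (t + δ)) ⟩
      sum (λ t → sum (λ δ → g t ℤ.* g (t + δ)))  ≡⟨ sum-cong-≗ (λ t → *-distribˡ-sum (g t) (λ δ → g (t + δ))) ⟨
      sum (λ t → g t ℤ.* sum (λ δ → g (t + δ)))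
          ≡⟨ sum-0 (λ t → trans (cong (g t ℤ.*_) (trans (sum-translateˡ g t) sum-g)) (ℤ.*-zeroʳ (g t))) ⟩
      0ℤ                                         ∎
      where open ≡-Reasoning

    -- For a ≠ 0 substitute u = a (y + t); the second argument is then u + a (z - y). For a = 0 the
    -- left term vanishes because g(0) = 0, whereas the autocorrelation at 0 is ‖g‖², which is the
    -- amount subtracted.
    sum-autocorrelation-scaled : ∀ y z →
      sum (λ a → sum (λ t → g (a * (y + t)) ℤ.* g (a * (z + t)))) ≡
      sum (λ a → autocorrelation (a * (- y + z))) ℤ.- ‖g‖²
    sum-autocorrelation-scaled y z = begin
      sum (λ a → sum (λ t → g (a * (y + t)) ℤ.* g (a * (z + t))))
        ≡⟨ sum-cong-≗ per-scale ⟩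
      sum (λ a → autocorrelation (a * (- y + z)) ℤ.- ⟦ a == 0# ⟧ ℤ.* autocorrelation (a * (- y + z)))
        ≡⟨ sum-distrib-- (λ a → autocorrelation (a * (- y + z)))
            (λ a → ⟦ a == 0# ⟧ ℤ.* autocorrelation (a * (- y + z))) ⟩
      sum (λ a → autocorrelation (a * (- y + z))) ℤ.- sum (λ a → ⟦ a == 0# ⟧ ℤ.* autocorrelation (a * (- y + z)))
        ≡⟨ cong (λ u → sum (λ a → autocorrelation (a * (- y + z))) ℤ.- u)
             (trans (sum-δ 0# (λ a → autocorrelation (a * (- y + z))))
                 (trans (cong autocorrelation (zeroˡ _)) autocorrelation-0)) ⟩
      sum (λ a → autocorrelation (a * (- y + z))) ℤ.- ‖g‖² ∎
      where
      open ≡-Reasoning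
      F : K → K → ℤ
      F a u = g u ℤ.* g (u + a * (- y + z))
      per-scale : ∀ a → sum (λ t → g (a * (y + t)) ℤ.* g (a * (z + t))) ≡
        autocorrelation (a * (- y + z)) ℤ.- ⟦ a == 0# ⟧ ℤ.* autocorrelation (a * (- y + z))
      per-scale a with a Fin.≟ 0#
      ... | yes refl = trans (sum-0 (λ t → cong (ℤ._* g (0# * (z + t))) (trans (cong g (zeroˡ (y + t))) g-0)))
                             (sym (trans (cong (λ u → R ℤ.- u) (ℤ.*-identityˡ R)) (ℤ.+-inverseʳ R)))
        where R = autocorrelation (0# * (- y + z))
      ... | no a≢0 = begin
        sum (λ t → g (a * (y + t)) ℤ.* g (a * (z + t)))
          ≡⟨ sum-cong-≗ (λ t → cong (λ u → g (a * (y + t)) ℤ.* g u) (shift t)) ⟩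
        sum (λ t → F a (a * (y + t)))
          ≡⟨ sum-translateˡ (λ t → F a (a * t)) y ⟩
        sum (λ t → F a (a * t))
          ≡⟨ sum-scale (F a) a≢0 ⟩
        autocorrelation (a * (- y + z))
          ≡⟨ ℤ.+-identityʳ _ ⟨
        autocorrelation (a * (- y + z)) ℤ.- 0ℤ ∎
        where
        shift : ∀ t → a * (z + t) ≡ a * (y + t) + a * (- y + z)
        shift t = trans (cong (a *_) (begin
          z + t                ≡⟨ +-comm z t ⟩
          t + z                ≡⟨ cong (_+_ t) (+--cancel y z) ⟨
          t + (y + (- y + z))  ≡⟨ +-assoc t y _ ⟨
          t + y + (- y + z)    ≡⟨ cong (_+ (- y + z)) (+-comm t y) ⟩
          y + t + (- y + z)    ∎)) (distribˡ a (y + t) (- y + z))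

    ‖g‖²-nonneg : 0ℤ ℤ.≤ ‖g‖²
    ‖g‖²-nonneg = sum-nonneg (λ x → square-nonneg (g x))

    -- On the diagonal each of the n + 1 autocorrelations is ‖g‖², and one of them is subtracted.
    -- Off the diagonal a (z - y) runs through K, the autocorrelations sum to 0, and -‖g‖² ≤ 0 is
    -- left.
    correlation-bound : ∀ y z → sum (λ a → sum (λ t → g (a * (y + t)) ℤ.* g (a * (z + t)))) ℤ.≤ ⟦ z == y ⟧ ℤ.*
        (+ n ℤ.* ‖g‖²)
    correlation-bound y z = ℤ.≤-trans (ℤ.≤-reflexive (sum-autocorrelation-scaled y z)) bound
      where
      open ℤ.≤-Reasoning
      bound : sum (λ a → autocorrelation (a * (- y + z))) ℤ.- ‖g‖² ℤ.≤ ⟦ z == y ⟧ ℤ.* (+ n ℤ.* ‖g‖²)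
      bound with z Fin.≟ y
      ... | yes refl = ℤ.≤-reflexive (begin-equality
        sum (λ a → autocorrelation (a * (- z + z))) ℤ.- ‖g‖²
          ≡⟨ cong (ℤ._- ‖g‖²) (sum-cong-≗
              (λ a → trans (cong autocorrelation (trans (cong (a *_) (-‿inverseˡ z)) (zeroʳ a))) autocorrelation-0)) ⟩
        sum {suc n} (λ a → ‖g‖²) ℤ.- ‖g‖²
          ≡⟨ cong (ℤ._- ‖g‖²) (sum-const (suc n) ‖g‖²) ⟩
        + suc n ℤ.* ‖g‖² ℤ.- ‖g‖²
          ≡⟨ cong (ℤ._- ‖g‖²) (ℤ.suc-* (+ n) ‖g‖²) ⟩
        ‖g‖² ℤ.+ + n ℤ.* ‖g‖² ℤ.- ‖g‖²
          ≡⟨ drop (‖g‖²) (+ n ℤ.* ‖g‖²) ⟩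
        1ℤ ℤ.* (+ n ℤ.* ‖g‖²) ∎)
        where
        drop : ∀ a b → a ℤ.+ b ℤ.- a ≡ 1ℤ ℤ.* b
        drop = solve-∀
      ... | no z≢y = begin
        sum (λ a → autocorrelation (a * (- y + z))) ℤ.- ‖g‖²
          ≡⟨ cong (ℤ._- ‖g‖²) (trans (sum-cong-≗ (λ a → cong autocorrelation (*-comm a (- y + z))))
              (trans (sum-scale autocorrelation -y+z≢0) sum-autocorrelation)) ⟩
        0ℤ ℤ.- ‖g‖²   ≡⟨ ℤ.+-identityˡ _ ⟩
        ℤ.- ‖g‖²      ≤⟨ ℤ.neg-mono-≤ ‖g‖²-nonneg ⟩
        0ℤ            ∎
        where
        -y+z≢0 : - y + z ≢ 0#
        -y+z≢0 eq = z≢y (trans (sym (+--cancel y z)) (trans (cong (_+_ y) eq) (+-identityʳ y)))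

    module _ (V : K → Bool) where

      twisted : K → K → ℤ
      twisted a t = sum (λ y → ⟦ V y ⟧ ℤ.* g (a * (y + t)))

      -- The square is expanded into pairs (y, z) of points of V. Their weights are nonnegative, so
      -- each correlation may be replaced by its bound and only the diagonal survives.
      twisted-second-moment : sum (λ a → sum (λ t → twisted a t ℤ.* twisted a t)) ℤ.≤
                              sum (λ y → ⟦ V y ⟧) ℤ.* (+ n ℤ.* ‖g‖²)
      twisted-second-moment = begin
        sum (λ a → sum (λ t → twisted a t ℤ.* twisted a t))
          ≡⟨ sum-cong-≗ (λ a → sum-cong-≗ (λ t → sum-*-sum (λ y → v y ℤ.* G a t y))) ⟩
        sum (λ a → sum (λ t → sum (λ y → sum (λ z → v y ℤ.* G a t y ℤ.* (v z ℤ.* G a t z)))))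
          ≡⟨ sum-swap₄ (λ a t y z → v y ℤ.* G a t y ℤ.* (v z ℤ.* G a t z)) ⟩
        sum (λ y → sum (λ z → sum (λ a → sum (λ t → v y ℤ.* G a t y ℤ.* (v z ℤ.* G a t z)))))
          ≡⟨ sum-cong-≗ (λ y → sum-cong-≗ (λ z → factor y z)) ⟩
        sum (λ y → sum (λ z → v y ℤ.* v z ℤ.* C y z))
          ≤⟨ sum-mono (λ y → sum-mono
              (λ z → *-monoˡ-nonneg (*-nonneg (⟦⟧-nonneg (V y)) (⟦⟧-nonneg (V z))) (correlation-bound y z))) ⟩
        sum (λ y → sum (λ z → v y ℤ.* v z ℤ.* (⟦ z == y ⟧ ℤ.* B)))
          ≡⟨ sum-cong-≗ (λ y → trans (sum-cong-≗ (λ z → rearrange (v y) (v z) ⟦ z == y ⟧ B))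
              (sum-δ y (λ z → v y ℤ.* v z ℤ.* B))) ⟩
        sum (λ y → v y ℤ.* v y ℤ.* B)
          ≡⟨ sum-cong-≗ (λ y → cong (ℤ._* B) (trans (sym (⟦∧⟧ (V y) (V y))) (cong ⟦_⟧ (Bool.∧-idem (V y))))) ⟩
        sum (λ y → v y ℤ.* B)
          ≡⟨ *-distribʳ-sum B v ⟨
        sum v ℤ.* B ∎
        where
        open ℤ.≤-Reasoning
        v : K → ℤ
        v y = ⟦ V y ⟧
        G : K → K → K → ℤ
        G a t y = g (a * (y + t))
        C : K → K → ℤ
        C y z = sum (λ a → sum (λ t → G a t y ℤ.* G a t z))
        B = + n ℤ.* ‖g‖²
        rearrange : ∀ a b c d → a ℤ.* b ℤ.* (c ℤ.* d) ≡ c ℤ.* (a ℤ.* b ℤ.* d)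
        rearrange = solve-∀
        pull : ∀ a b c d → a ℤ.* b ℤ.* (c ℤ.* d) ≡ a ℤ.* c ℤ.* (b ℤ.* d)
        pull = solve-∀
        factor : ∀ y z → sum (λ a → sum (λ t → v y ℤ.* G a t y ℤ.* (v z ℤ.* G a t z))) ≡ v y ℤ.* v z ℤ.* C y z
        factor y z = sym (trans (*-distribˡ-sum (v y ℤ.* v z) (λ a → sum (λ t → G a t y ℤ.* G a t z)))
          (sum-cong-≗ (λ a → trans (*-distribˡ-sum (v y ℤ.* v z) (λ t → G a t y ℤ.* G a t z))
            (sum-cong-≗ (λ t → sym (pull (v y) (G a t y) (v z) (G a t z)))))))

      module _ (aff : IsAffine V) (H : K → Bool) (g-invariant : ∀ {a} → H a ≡ true → ∀ x → g (a * x) ≡ g x) where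

        -- Translating V by a difference of two of its points, or scaling by H, leaves the sum unchanged;
        -- so the value at (1, 0) is repeated |H| |V| times in the second moment.
        affine-sum-bound : sum (λ a → ⟦ H a ⟧) ℤ.* (sum (λ y → ⟦ V y ⟧ ℤ.* g y) ℤ.* sum (λ y → ⟦ V y ⟧ ℤ.* g y)) ℤ.≤
            + n ℤ.* ‖g‖²
        affine-sum-bound with Fin.any? (λ y → V y Bool.≟ true)
        ... | no ∄ = begin
          ∣H∣ ℤ.* (sum (λ y → ⟦ V y ⟧ ℤ.* g y) ℤ.* sum (λ y → ⟦ V y ⟧ ℤ.* g y))
            ≡⟨ cong (λ u → ∣H∣ ℤ.* (u ℤ.* u))
                (sum-0 (λ y → cong (λ b → ⟦ b ⟧ ℤ.* g y) (Bool.¬-not (λ h → ∄ (y , h))))) ⟩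
          ∣H∣ ℤ.* 0ℤ        ≡⟨ ℤ.*-zeroʳ ∣H∣ ⟩
          0ℤ                ≤⟨ *-nonneg {+ n} (+≤+ ℕ.z≤n) ‖g‖²-nonneg ⟩
          + n ℤ.* ‖g‖²      ∎
          where
          open ℤ.≤-Reasoning
          ∣H∣ = sum (λ a → ⟦ H a ⟧)
        ... | yes (v₀ , v₀∈V) = cancel-pos (sum v) 1≤∣V∣ (begin
          sum v ℤ.* (∣H∣ ℤ.* (Φ ℤ.* Φ))
            ≡⟨ reorder (sum v) ∣H∣ (Φ ℤ.* Φ) ⟩
          ∣H∣ ℤ.* (sum v ℤ.* (Φ ℤ.* Φ))
            ≡⟨ cong (λ u → ∣H∣ ℤ.* (u ℤ.* (Φ ℤ.* Φ))) (sum-translateʳ v v₀) ⟨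
          ∣H∣ ℤ.* (sum (λ t → v (t + v₀)) ℤ.* (Φ ℤ.* Φ))
            ≡⟨ cong (∣H∣ ℤ.*_) (*-distribʳ-sum (Φ ℤ.* Φ) (λ t → v (t + v₀))) ⟩
          ∣H∣ ℤ.* sum (λ t → v (t + v₀) ℤ.* (Φ ℤ.* Φ))
            ≡⟨ *-distribʳ-sum (sum (λ t → v (t + v₀) ℤ.* (Φ ℤ.* Φ))) (λ a → ⟦ H a ⟧) ⟩
          sum (λ a → ⟦ H a ⟧ ℤ.* sum (λ t → v (t + v₀) ℤ.* (Φ ℤ.* Φ)))
            ≡⟨ sum-cong-≗ (λ a → *-distribˡ-sum ⟦ H a ⟧ (λ t → v (t + v₀) ℤ.* (Φ ℤ.* Φ))) ⟩
          sum (λ a → sum (λ t → ⟦ H a ⟧ ℤ.* (v (t + v₀) ℤ.* (Φ ℤ.* Φ))))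
            ≤⟨ sum-mono (λ a → sum-mono (λ t → repeated a t)) ⟩
          sum (λ a → sum (λ t → twisted a t ℤ.* twisted a t))
            ≤⟨ twisted-second-moment ⟩
          sum v ℤ.* (+ n ℤ.* ‖g‖²) ∎)
          where
          open ℤ.≤-Reasoning
          v : K → ℤ
          v y = ⟦ V y ⟧
          ∣H∣ = sum (λ a → ⟦ H a ⟧)
          Φ = sum (λ y → v y ℤ.* g y)
          1≤∣V∣ : 1ℤ ℤ.≤ sum v
          1≤∣V∣ = ℤ.≤-trans (ℤ.≤-reflexive (cong ⟦_⟧ (sym v₀∈V))) (term≤sum v (λ y → ⟦⟧-nonneg (V y)) v₀)
          cancel-pos : ∀ k {i j} → 1ℤ ℤ.≤ k → k ℤ.* i ℤ.≤ k ℤ.* j → i ℤ.≤ j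
          cancel-pos (+ suc k) _ = ℤ.*-cancelˡ-≤-pos _ _ (+ suc k)
          cancel-pos (+ zero) (+≤+ ())
          reorder : ∀ a b c → a ℤ.* (b ℤ.* c) ≡ b ℤ.* (a ℤ.* c)
          reorder = solve-∀
          -- The condition t + v₀ ∈ V says that t lies in the direction subgroup of V. Both
          -- implications are instances of closure, since y = (y + t) - (t + v₀) + v₀ and y + t = y
          -- - v₀ + (t + v₀).
          V-periodic : ∀ {t} → V (t + v₀) ≡ true → ∀ y → V (y + t) ≡ V y
          V-periodic {t} t∈ y = bool-iff
            (λ h → subst (λ u → V u ≡ true) (untranslate y t v₀) (closed aff h t∈ v₀∈V))
            (λ h → subst (λ u → V u ≡ true)
                (cong (_+_ y) (trans (cong (_+_ (- v₀)) (+-comm t v₀)) (-+-cancel v₀ t))) (closed aff h v₀∈V t∈))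
          repeated : ∀ a t → ⟦ H a ⟧ ℤ.* (v (t + v₀) ℤ.* (Φ ℤ.* Φ)) ℤ.≤ twisted a t ℤ.* twisted a t
          repeated a t with H a in a∈H | V (t + v₀) in t∈
          ... | false | _ = square-nonneg (twisted a t)
          ... | true | false = square-nonneg (twisted a t)
          ... | true | true = ℤ.≤-reflexive (begin-equality
            1ℤ ℤ.* (1ℤ ℤ.* (Φ ℤ.* Φ))          ≡⟨ trans (ℤ.*-identityˡ _) (ℤ.*-identityˡ _) ⟩
            Φ ℤ.* Φ                            ≡⟨ cong₂ ℤ._*_ Φ≡ Φ≡ ⟨
            twisted a t ℤ.* twisted a t        ∎)
            where
            Φ≡ : twisted a t ≡ Φ
            Φ≡ = begin-equality
              sum (λ y → v y ℤ.* g (a * (y + t)))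
                  ≡⟨ sum-cong-≗ (λ y → cong₂ ℤ._*_ (cong ⟦_⟧ (sym (V-periodic t∈ y))) (g-invariant a∈H (y + t))) ⟩
              sum (λ y → v (y + t) ℤ.* g (y + t))    ≡⟨ sum-translateʳ (λ y → v y ℤ.* g y) t ⟩
              Φ                                      ∎

  -- Inclusion-exclusion over affine subsets

  avoids : List (K → Bool) → K → Bool
  avoids Vs x = all (λ V → not (V x)) Vs

  module _ {d : ℕ} (d∣n : d ∣ n) (s : ℕ) (n≤s² : n ℕ.≤ s ℕ.* s) where
    private
      h : K → Bool
      h = power d

      g : K → ℤ
      g x = + d ℤ.* ⟦ h x ⟧ ℤ.- ⟦ nonzero x ⟧

      h-0 : h 0# ≡ false
      h-0 = Bool.¬-not (λ e → power⇒nonzero d∣n e refl)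

      g-0 : g 0# ≡ 0ℤ
      g-0 = trans (cong₂ (λ a b → + d ℤ.* ⟦ a ⟧ ℤ.- ⟦ b ⟧) h-0 (cong not (does⁺ (0# Fin.≟ 0#) refl)))
        (trans (ℤ.+-identityʳ _) (ℤ.*-zeroʳ (+ d)))

      ∣H∣ = sum (λ x → ⟦ h x ⟧)

      sum-g : sum g ≡ 0ℤ
      sum-g = begin
        sum g ≡⟨ sum-distrib-- (λ x → + d ℤ.* ⟦ h x ⟧) (λ x → ⟦ nonzero x ⟧) ⟩
        sum (λ x → + d ℤ.* ⟦ h x ⟧) ℤ.- sum (λ x → ⟦ nonzero x ⟧)
            ≡⟨ cong₂ ℤ._-_ (trans (sym (*-distribˡ-sum (+ d) (λ x → ⟦ h x ⟧))) (sum-power d∣n)) sum-nonzero ⟩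
        + n ℤ.- + n ≡⟨ ℤ.+-inverseʳ (+ n) ⟩
        0ℤ ∎
        where open ≡-Reasoning

      open SecondMoment g g-0 sum-g

      g-invariant : ∀ {a} → h a ≡ true → ∀ x → g (a * x) ≡ g x
      g-invariant {a} a∈H x = cong₂ (λ b c → + d ℤ.* ⟦ b ⟧ ℤ.- ⟦ c ⟧) (power-*-invariant d∣n a∈H x)
        (trans (sym (power-1 (a * x)))
            (trans (power-*-invariant (1∣ n) (trans (power-1 a) (nonzero⁺ (power⇒nonzero d∣n a∈H))) x) (power-1 x)))

      -- The value is exactly d n - n: the square of g is (d² - 2 d) 1_H plus the indicator of the
      -- nonzero elements, and d |H| = n.
      ‖g‖²≤ : ‖g‖² ℤ.≤ + d ℤ.* + n
      ‖g‖²≤ = begin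
        ‖g‖²
          ≡⟨ sum-cong-≗ expand ⟩
        sum (λ x → (+ d ℤ.* + d ℤ.- + 2 ℤ.* + d) ℤ.* ⟦ h x ⟧ ℤ.+ ⟦ nonzero x ⟧)
          ≡⟨ ∑-distrib-+ (λ x → (+ d ℤ.* + d ℤ.- + 2 ℤ.* + d) ℤ.* ⟦ h x ⟧) (λ x → ⟦ nonzero x ⟧) ⟩
        sum (λ x → (+ d ℤ.* + d ℤ.- + 2 ℤ.* + d) ℤ.* ⟦ h x ⟧) ℤ.+ sum (λ x → ⟦ nonzero x ⟧)
          ≡⟨ cong₂ ℤ._+_ (sym (*-distribˡ-sum (+ d ℤ.* + d ℤ.- + 2 ℤ.* + d) (λ x → ⟦ h x ⟧))) sum-nonzero ⟩
        (+ d ℤ.* + d ℤ.- + 2 ℤ.* + d) ℤ.* ∣H∣ ℤ.+ + n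
          ≡⟨ regroup (+ d) ∣H∣ (+ n) ⟩
        (+ d ℤ.* (+ d ℤ.* ∣H∣) ℤ.- + 2 ℤ.* (+ d ℤ.* ∣H∣)) ℤ.+ + n
          ≡⟨ cong (λ u → (+ d ℤ.* u ℤ.- + 2 ℤ.* u) ℤ.+ + n) (sum-power d∣n) ⟩
        (+ d ℤ.* + n ℤ.- + 2 ℤ.* + n) ℤ.+ + n
          ≡⟨ subtract (+ d) (+ n) ⟩
        + d ℤ.* + n ℤ.- + n
          ≤⟨ ℤ.i≤j⇒i-k≤j (+ n) ℤ.≤-refl ⟩
        + d ℤ.* + n ∎
        where
        open ℤ.≤-Reasoning
        regroup : ∀ d H n → (d ℤ.* d ℤ.- + 2 ℤ.* d) ℤ.* H ℤ.+ n ≡ (d ℤ.* (d ℤ.* H) ℤ.- + 2 ℤ.* (d ℤ.* H)) ℤ.+ n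
        regroup = solve-∀
        subtract : ∀ d n → (d ℤ.* n ℤ.- + 2 ℤ.* n) ℤ.+ n ≡ d ℤ.* n ℤ.- n
        subtract = solve-∀
        expand : ∀ x → g x ℤ.* g x ≡ (+ d ℤ.* + d ℤ.- + 2 ℤ.* + d) ℤ.* ⟦ h x ⟧ ℤ.+ ⟦ nonzero x ⟧
        expand x with h x in hx | nonzero x in nz
        ... | true | true = square (+ d)
          where
          square : ∀ d → (d ℤ.* 1ℤ ℤ.- 1ℤ) ℤ.* (d ℤ.* 1ℤ ℤ.- 1ℤ) ≡ (d ℤ.* d ℤ.- + 2 ℤ.* d) ℤ.* 1ℤ ℤ.+ 1ℤ
          square = solve-∀
        ... | true | false = contradiction (trans (sym (nonzero⁺ (power⇒nonzero d∣n hx))) nz) λ ()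
        ... | false | true = square (+ d)
          where
          square : ∀ d → (d ℤ.* 0ℤ ℤ.- 1ℤ) ℤ.* (d ℤ.* 0ℤ ℤ.- 1ℤ) ≡ (d ℤ.* d ℤ.- + 2 ℤ.* d) ℤ.* 0ℤ ℤ.+ 1ℤ
          square = solve-∀
        ... | false | false = square (+ d)
          where
          square : ∀ d → (d ℤ.* 0ℤ ℤ.- 0ℤ) ℤ.* (d ℤ.* 0ℤ ℤ.- 0ℤ) ≡ (d ℤ.* d ℤ.- + 2 ℤ.* d) ℤ.* 0ℤ ℤ.+ 0ℤ
          square = solve-∀

      -- Because n = d |H|, the bound n ‖g‖² ≤ n d n equals |H| d² n, and |H| cancels; it is
      -- positive since d |H| = n is nonzero.
      affine-bound : ∀ {V} → IsAffine V → ∣ sum (λ y → ⟦ V y ⟧ ℤ.* g y) ∣ ℕ.≤ d ℕ.* s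
      affine-bound {V} aff = abs-≤-from-square Φ (d ℕ.* s) (cancel ∣H∣ refl (begin
        ∣H∣ ℤ.* (Φ ℤ.* Φ)                     ≤⟨ affine-sum-bound V aff h g-invariant ⟩
        + n ℤ.* ‖g‖²                          ≤⟨ *-monoˡ-nonneg {k = + n} (+≤+ ℕ.z≤n) ‖g‖²≤ ⟩
        + n ℤ.* (+ d ℤ.* + n)                 ≡⟨ cong (λ u → u ℤ.* (+ d ℤ.* + n)) (sum-power d∣n) ⟨
        + d ℤ.* ∣H∣ ℤ.* (+ d ℤ.* + n)         ≡⟨ regroup (+ d) ∣H∣ (+ n) ⟩
        ∣H∣ ℤ.* (+ d ℤ.* + d ℤ.* + n)
            ≡⟨ cong (∣H∣ ℤ.*_) (trans (cong (ℤ._* + n) (sym (ℤ.pos-* d d))) (sym (ℤ.pos-* (d ℕ.* d) n))) ⟩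
        ∣H∣ ℤ.* + (d ℕ.* d ℕ.* n)
            ≤⟨ *-monoˡ-nonneg {k = ∣H∣} (sum-nonneg (λ x → ⟦⟧-nonneg (h x)))
                (+≤+ (ℕ.≤-trans (ℕ.*-monoʳ-≤ (d ℕ.* d) n≤s²) (ℕ.≤-reflexive (square d s)))) ⟩
        ∣H∣ ℤ.* + (d ℕ.* s ℕ.* (d ℕ.* s))     ∎))
        where
        open ℤ.≤-Reasoning
        Φ = sum (λ y → ⟦ V y ⟧ ℤ.* g y)
        regroup : ∀ d H n → d ℤ.* H ℤ.* (d ℤ.* n) ≡ H ℤ.* (d ℤ.* d ℤ.* n)
        regroup = solve-∀
        square : ∀ d s → d ℕ.* d ℕ.* (s ℕ.* s) ≡ d ℕ.* s ℕ.* (d ℕ.* s)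
        square = ℕSolver.solve-∀
        cancel : ∀ k {i j} → k ≡ ∣H∣ → k ℤ.* i ℤ.≤ k ℤ.* j → i ℤ.≤ j
        cancel (+ suc k) _ = ℤ.*-cancelˡ-≤-pos _ _ (+ suc k)
        cancel (+ zero) 0≡ _ = contradiction
            (ℤ.+-injective (trans (sym (sum-power d∣n)) (trans (cong (+ d ℤ.*_) (sym 0≡)) (ℤ.*-zeroʳ (+ d)))))
                (ℕ.≢-nonZero⁻¹ n)
        cancel -[1+ k ] -k≡ _ = contradiction (subst (0ℤ ℤ.≤_) (sym -k≡) (sum-nonneg (λ x → ⟦⟧-nonneg (h x)))) λ ()

    -- Removing U from V subtracts the sum over V ∩ U, which is affine again. Each set in the list
    -- therefore doubles the number of affine sums, and the induction has to allow an arbitrary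
    -- affine V.
    avoids-bound : ∀ {V Vs} → IsAffine V → All IsAffine Vs →
      ∣ sum (λ x → ⟦ V x ∧ avoids Vs x ⟧ ℤ.* (+ d ℤ.* ⟦ power d x ⟧ ℤ.- ⟦ nonzero x ⟧)) ∣ ℕ.≤ 2 ℕ.^ length Vs ℕ.*
          (d ℕ.* s)
    avoids-bound {V} {[]} aff [] = ℕ.≤-trans
      (ℕ.≤-reflexive (cong ∣_∣ (sum-cong-≗ (λ x → cong (λ b → ⟦ b ⟧ ℤ.* g x) (Bool.∧-identityʳ (V x))))))
      (ℕ.≤-trans (affine-bound aff) (ℕ.≤-reflexive (sym (ℕ.*-identityˡ _))))
    avoids-bound {V} {U ∷ Vs} aff (aff-U ∷ affs) = begin
      ∣ sum (λ x → ⟦ V x ∧ (not (U x) ∧ avoids Vs x) ⟧ ℤ.* g x) ∣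
        ≡⟨ cong ∣_∣ (trans (sum-cong-≗ (λ x → split (V x) (U x) (avoids Vs x) (g x)))
             (sum-distrib-- (λ x → ⟦ V x ∧ avoids Vs x ⟧ ℤ.* g x) (λ x → ⟦ (V x ∧ U x) ∧ avoids Vs x ⟧ ℤ.* g x))) ⟩
      ∣ A ℤ.- B ∣
        ≤⟨ ℤ.∣i-j∣≤∣i∣+∣j∣ A B ⟩
      ∣ A ∣ ℕ.+ ∣ B ∣
        ≤⟨ ℕ.+-mono-≤ (avoids-bound aff affs) (avoids-bound (∩-affine aff aff-U) affs) ⟩
      2 ℕ.^ length Vs ℕ.* (d ℕ.* s) ℕ.+ 2 ℕ.^ length Vs ℕ.* (d ℕ.* s)
        ≡⟨ double (2 ℕ.^ length Vs) (d ℕ.* s) ⟩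
      2 ℕ.* 2 ℕ.^ length Vs ℕ.* (d ℕ.* s) ∎
      where
      open ℕ.≤-Reasoning
      A = sum (λ x → ⟦ V x ∧ avoids Vs x ⟧ ℤ.* g x)
      B = sum (λ x → ⟦ (V x ∧ U x) ∧ avoids Vs x ⟧ ℤ.* g x)
      double : ∀ a b → a ℕ.* b ℕ.+ a ℕ.* b ≡ 2 ℕ.* a ℕ.* b
      double = ℕSolver.solve-∀
      split : ∀ a b c i → ⟦ a ∧ (not b ∧ c) ⟧ ℤ.* i ≡ ⟦ a ∧ c ⟧ ℤ.* i ℤ.- ⟦ (a ∧ b) ∧ c ⟧ ℤ.* i
      split false b c i = refl
      split true true true i = sym (ℤ.+-inverseʳ (1ℤ ℤ.* i))
      split true true false i = refl
      split true false c i = sym (ℤ.+-identityʳ _)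

  -- Sieving the complement of affine subsets for generators

  open Sieve n power power-*

  survivor : K → Bool
  survivor x = power 1 x ∧ survives (primeDivisors n) x

  survivor-generates : ∀ {x} → survivor x ≡ true → x ≢ 0# × (∀ y → y ≢ 0# → ∃ λ k → x ^ k ≡ y)
  survivor-generates {x} h =
    let x∈ , survives = ∧-true⁻ {power 1 x} h
        x≢0 = power⇒nonzero (1∣ n) x∈
    in x≢0 , generates x≢0 λ {p} p-prime p∣n →
      trans (sym (Bool.not-involutive (power p x)))
          (cong not (all-∈ (λ p → not (power p x)) survives (primeDivisors-complete n p-prime p∣n)))

  module _ (Vs : List (K → Bool)) (aff : All IsAffine Vs) (s : ℕ) (n≤s² : n ℕ.≤ s ℕ.* s)
    {R N : ℕ} (R≤ : + R ℤ.≤ sum (λ x → ⟦ avoids Vs x ⟧)) (≤N : sum (λ x → ⟦ avoids Vs x ∧ survivor x ⟧) ℤ.≤ + N) where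
    private
      w : K → ℤ
      w x = ⟦ avoids Vs x ⟧

      T = sum (λ x → w x ℤ.* ⟦ nonzero x ⟧)
      E = 2 ℕ.^ length Vs ℕ.* s
      ps = primeDivisors n
      Π = product ps
      Π′ = ∏∸1 ps
      M = 2 ℕ.^ length ps

      equidistributed : ∀ {e} → e ∣ n → ∣ + e ℤ.* sum (λ x → w x ℤ.* ⟦ power e x ⟧) ℤ.- T ∣ ℕ.≤ e ℕ.* E
      equidistributed {e} e∣n = begin
        ∣ + e ℤ.* sum (λ x → w x ℤ.* ⟦ power e x ⟧) ℤ.- T ∣
          ≡⟨ cong (λ u → ∣ u ℤ.- T ∣) (*-distribˡ-sum (+ e) (λ x → w x ℤ.* ⟦ power e x ⟧)) ⟩
        ∣ sum (λ x → + e ℤ.* (w x ℤ.* ⟦ power e x ⟧)) ℤ.- T ∣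
          ≡⟨ cong ∣_∣ (sum-distrib-- (λ x → + e ℤ.* (w x ℤ.* ⟦ power e x ⟧)) (λ x → w x ℤ.* ⟦ nonzero x ⟧)) ⟨
        ∣ sum (λ x → + e ℤ.* (w x ℤ.* ⟦ power e x ⟧) ℤ.- w x ℤ.* ⟦ nonzero x ⟧) ∣
          ≡⟨ cong ∣_∣ (sum-cong-≗ (λ x → factor (+ e) (w x) ⟦ power e x ⟧ ⟦ nonzero x ⟧)) ⟩
        ∣ sum (λ x → w x ℤ.* (+ e ℤ.* ⟦ power e x ⟧ ℤ.- ⟦ nonzero x ⟧)) ∣
          -- The deviation has become the sum of g over the complement, and inclusion-exclusion
          -- starts from V = K.
          ≤⟨ avoids-bound e∣n s n≤s² {λ _ → true} (affine λ _ _ _ → refl) aff ⟩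
        2 ℕ.^ length Vs ℕ.* (e ℕ.* s)
          ≡⟨ reorder (2 ℕ.^ length Vs) e s ⟩
        e ℕ.* E ∎
        where
        open ℕ.≤-Reasoning
        factor : ∀ e w h z → e ℤ.* (w ℤ.* h) ℤ.- w ℤ.* z ≡ w ℤ.* (e ℤ.* h ℤ.- z)
        factor = solve-∀
        reorder : ∀ a b c → a ℕ.* (b ℕ.* c) ≡ b ℕ.* (a ℕ.* c)
        reorder = ℕSolver.solve-∀

      -- The main term counts nonzero elements, while 0 may itself avoid every set of the list, so
      -- at most one element is lost.
      R∸1≤T : + (R ℕ.∸ 1) ℤ.≤ T
      R∸1≤T = drop-one R (begin
        + R                                                ≤⟨ R≤ ⟩
        sum w                                              ≤⟨ sum-mono split ⟩
        sum (λ x → w x ℤ.* ⟦ nonzero x ⟧ ℤ.+ ⟦ x == 0# ⟧)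
            ≡⟨ ∑-distrib-+ (λ x → w x ℤ.* ⟦ nonzero x ⟧) (λ x → ⟦ x == 0# ⟧) ⟩
        T ℤ.+ sum (λ x → ⟦ x == 0# ⟧)                      ≡⟨ cong (ℤ._+_ T) (sum-== 0#) ⟩
        T ℤ.+ 1ℤ                                           ∎)
        where
        open ℤ.≤-Reasoning
        split : ∀ x → w x ℤ.≤ w x ℤ.* ⟦ nonzero x ⟧ ℤ.+ ⟦ x == 0# ⟧
        split x with x == 0#
        ... | true = ℤ.≤-trans (⟦⟧-≤1 (avoids Vs x)) (ℤ.≤-reflexive (sym (cong (ℤ._+ 1ℤ) (ℤ.*-zeroʳ (w x)))))
        ... | false = ℤ.≤-reflexive (sym (trans (ℤ.+-identityʳ _) (ℤ.*-identityʳ (w x))))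
        0≤T : 0ℤ ℤ.≤ T
        0≤T = sum-nonneg (λ x → *-nonneg (⟦⟧-nonneg (avoids Vs x)) (⟦⟧-nonneg (nonzero x)))
        cancel : ∀ t → t ℤ.+ 1ℤ ℤ.- 1ℤ ≡ t
        cancel = solve-∀
        drop-one : ∀ R → + R ℤ.≤ T ℤ.+ 1ℤ → + (R ℕ.∸ 1) ℤ.≤ T
        drop-one zero _ = 0≤T
        drop-one (suc R-1) le = ℤ.≤-trans (ℤ.+-monoˡ-≤ (ℤ.- 1ℤ) le) (ℤ.≤-reflexive (cancel T))

    avoids-sieve : Π′ ℕ.* (R ℕ.∸ 1) ℕ.≤ Π ℕ.* N ℕ.+ Π ℕ.* (M ℕ.* E)
    avoids-sieve = ℤ.drop‿+≤+ (begin
      + (Π′ ℕ.* (R ℕ.∸ 1))               ≡⟨ ℤ.pos-* Π′ (R ℕ.∸ 1) ⟩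
      + Π′ ℤ.* + (R ℕ.∸ 1)               ≤⟨ *-monoˡ-nonneg {k = + Π′} (+≤+ ℕ.z≤n) R∸1≤T ⟩
      + Π′ ℤ.* T                         ≤⟨ ∣-∣⇒≤ (+ Π ℤ.* A) (+ Π′ ℤ.* T) sieved ⟩
      + Π ℤ.* A ℤ.+ + (Π ℕ.* (M ℕ.* E))
          ≤⟨ ℤ.+-monoˡ-≤ (+ (Π ℕ.* (M ℕ.* E)))
              (*-monoˡ-nonneg {k = + Π} (+≤+ ℕ.z≤n) (ℤ.≤-trans (ℤ.≤-reflexive (sum-cong-≗ interpret)) ≤N)) ⟩
      + Π ℤ.* + N ℤ.+ + (Π ℕ.* (M ℕ.* E)) ≡⟨ cong (ℤ._+ + (Π ℕ.* (M ℕ.* E))) (ℤ.pos-* Π N) ⟨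
      + (Π ℕ.* N ℕ.+ Π ℕ.* (M ℕ.* E))    ∎)
      where
      open ℤ.≤-Reasoning
      A = sum (λ x → w x ℤ.* sift ps 1 x)
      interpret : ∀ x → w x ℤ.* sift ps 1 x ≡ ⟦ avoids Vs x ∧ survivor x ⟧
      interpret x = trans (cong (w x ℤ.*_) (sift-survives (primeDivisors-siftable n) x))
          (sym (⟦∧⟧ (avoids Vs x) (survivor x)))
      sieved : ∣ + Π ℤ.* A ℤ.- + Π′ ℤ.* T ∣ ℕ.≤ Π ℕ.* (M ℕ.* E)
      sieved = subst₂ (λ a b → ∣ a ℤ.* A ℤ.- + Π′ ℤ.* T ∣ ℕ.≤ b ℕ.* (M ℕ.* E)) (ℤ.*-identityˡ (+ Π)) (ℕ.*-identityˡ Π)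
        (sieve-bound n power power-* w T E equidistributed (primeDivisors-siftable n))
      ∣-∣⇒≤ : ∀ i j {b} → ∣ i ℤ.- j ∣ ℕ.≤ b → j ℤ.≤ i ℤ.+ + b
      ∣-∣⇒≤ i j {b} le = begin
        j                         ≡⟨ recombine i j ⟩
        i ℤ.+ ℤ.- (i ℤ.- j)
            ≤⟨ ℤ.+-monoʳ-≤ i (ℤ.≤-trans (i≤∣i∣ (ℤ.- (i ℤ.- j)))
                (+≤+ (ℕ.≤-trans (ℕ.≤-reflexive (ℤ.∣-i∣≡∣i∣ (i ℤ.- j))) le))) ⟩
        i ℤ.+ + b                 ∎
        where
        recombine : ∀ i j → j ≡ i ℤ.+ ℤ.- (i ℤ.- j)
        recombine = solve-∀
        i≤∣i∣ : ∀ i → i ℤ.≤ + ∣ i ∣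
        i≤∣i∣ (+ m) = ℤ.≤-refl
        i≤∣i∣ -[1+ m ] = ℤ.-≤+

-- Coordinates and the box G_A

module Transport (F : FiniteField) (n : ℕ) (size≡ : FiniteField.size F ≡ suc n) where
  open FiniteField F using (enum; enum-surj; enum-inj; 1≉0; inverse) renaming (ring to R)
  open CommutativeRing R using (Carrier; _≈_; _+_; _*_; -_; 0#; 1#; rawRing; *-cong) renaming
      (refl to ≈-refl; sym to ≈-sym; trans to ≈-trans; isCommutativeRing to R-isCommutativeRing; reflexive to
          ≈-reflexive)

  element : Fin (suc n) → Carrier
  element i = enum (Fin.cast (sym size≡) i)

  index : Carrier → Fin (suc n)
  index x = Fin.cast size≡ (proj₁ (enum-surj x))

  element-index : ∀ x → element (index x) ≈ x
  element-index x = ≈-trans (≈-reflexive (cong enum (Fin.cast-involutive (sym size≡) size≡ (proj₁ (enum-surj x)))))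
      (proj₂ (enum-surj x))

  element-injective : ∀ {i j} → element i ≈ element j → i ≡ j
  element-injective {i} {j} eq = trans (sym (Fin.cast-involutive size≡ (sym size≡) i))
    (trans (cong (Fin.cast size≡) (enum-inj _ _ eq)) (Fin.cast-involutive size≡ (sym size≡) j))

  index-cong : ∀ {x y} → x ≈ y → index x ≡ index y
  index-cong x≈y = element-injective (≈-trans (element-index _) (≈-trans x≈y (≈-sym (element-index _))))

  index-injective : ∀ {x y} → index x ≡ index y → x ≈ y
  index-injective eq = ≈-trans (≈-sym (element-index _)) (≈-trans (≈-reflexive (cong element eq)) (element-index _))

  index-element : ∀ i → index (element i) ≡ i
  index-element i = element-injective (element-index (element i))

  -- The ring is pulled back along the enumeration so that equality becomes propositional and
  -- decidable, and sums over the field become sums over `Fin`.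
  rawFinRing : RawRing 0ℓ 0ℓ
  rawFinRing = record
    { Carrier = Fin (suc n)
    ; _≈_ = _≡_
    ; _+_ = λ i j → index (element i + element j)
    ; _*_ = λ i j → index (element i * element j)
    ; -_ = λ i → index (- element i)
    ; 0# = index 0#
    ; 1# = index 1#
    }

  element-isRingMonomorphism : IsRingMonomorphism rawFinRing rawRing element
  element-isRingMonomorphism = record
    { isRingHomomorphism = record
      { isSemiringHomomorphism = record
        { isNearSemiringHomomorphism = record
          { +-isMonoidHomomorphism = record
            { isMagmaHomomorphism = record
              { isRelHomomorphism = record { cong = λ eq → ≈-reflexive (cong element eq) }
              ; homo = λ _ _ → element-index _
              }
            ; ε-homo = element-index 0#
            }
          ; *-homo = λ _ _ → element-index _
          }
        ; 1#-homo = element-index 1#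
        }
      ; -‿homo = λ _ → element-index _
      }
    ; injective = element-injective
    }

  isCommutativeRing : IsCommutativeRing _≡_ (RawRing._+_ rawFinRing) (RawRing._*_ rawFinRing)
      (RawRing.-_ rawFinRing) (index 0#) (index 1#)
  isCommutativeRing = RingMonomorphism.isCommutativeRing element-isRingMonomorphism R-isCommutativeRing

  1≢0 : index 1# ≢ index 0#
  1≢0 eq = 1≉0 (index-injective eq)

  element-inverse : ∀ i → i ≢ index 0# → ∃ λ j → index (element i * element j) ≡ index 1#
  element-inverse i i≢0 =
    let y , xy≈1 = inverse (element i) (λ eq → i≢0 (trans (sym (index-element i)) (index-cong eq)))
    in index y , index-cong (≈-trans (*-cong ≈-refl (element-index y)) xy≈1)

module LinearSums (F : FiniteField) where
  open FiniteField F using () renaming (ring to R)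
  open CommutativeRing R using (Carrier; _≈_; _+_; _*_; -_; 0#; setoid; +-cong; +-identityˡ; distribʳ; ring)
  open import Relation.Binary.Reasoning.Setoid setoid
  open RingProperties ring using (-‿distribˡ-*; -‿+-comm; -0#≈0#)
  open CommutativeSemigroupProperties (CommutativeRing.+-commutativeSemigroup R) using (interchange)

  sumF-+ : ∀ {m} (a b α : Fin m → Carrier) →
    sumF F (λ i → (a i + b i) * α i) ≈ sumF F (λ i → a i * α i) + sumF F (λ i → b i * α i)
  sumF-+ {zero} a b α = CommutativeRing.sym R (+-identityˡ 0#)
  sumF-+ {suc m} a b α = begin
    (a zero + b zero) * α zero + sumF F (λ i → (a (suc i) + b (suc i)) * α (suc i))
      ≈⟨ +-cong (distribʳ (α zero) (a zero) (b zero)) (sumF-+ (a ∘ suc) (b ∘ suc) (α ∘ suc)) ⟩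
    (a zero * α zero + b zero * α zero) +
        (sumF F (λ i → a (suc i) * α (suc i)) + sumF F (λ i → b (suc i) * α (suc i)))
      ≈⟨ interchange _ _ _ _ ⟩
    (a zero * α zero + sumF F (λ i → a (suc i) * α (suc i))) +
        (b zero * α zero + sumF F (λ i → b (suc i) * α (suc i))) ∎

  sumF-neg : ∀ {m} (a α : Fin m → Carrier) → sumF F (λ i → (- a i) * α i) ≈ - sumF F (λ i → a i * α i)
  sumF-neg {zero} a α = CommutativeRing.sym R -0#≈0#
  sumF-neg {suc m} a α = begin
    (- a zero) * α zero + sumF F (λ i → (- a (suc i)) * α (suc i))
      ≈⟨ +-cong (CommutativeRing.sym R (-‿distribˡ-* (a zero) (α zero))) (sumF-neg (a ∘ suc) (α ∘ suc)) ⟩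
    - (a zero * α zero) + - sumF F (λ i → a (suc i) * α (suc i))
      ≈⟨ -‿+-comm _ _ ⟩
    - (a zero * α zero + sumF F (λ i → a (suc i) * α (suc i))) ∎

module Box (F : FiniteField) (n : ℕ) .{{n≢0 : ℕ.NonZero n}} (size≡ : FiniteField.size F ≡ suc n)
  (Fq : Subfield F) {Q : ℕ} (Fq-card : HasCard F (Subfield.mem Fq) (suc Q))
  {r : ℕ} (α : Fin r → FiniteField.Carrier F) (basis : IsBasisOver F (Subfield.mem Fq) (λ _ → ⊤) α)
  (c : Fin r → FiniteField.Carrier F) (c∈Fq : ∀ i → Subfield.mem Fq (c i)) where

  open FiniteField F using () renaming (ring to R)
  open CommutativeRing R using
      (Carrier; _≈_; _+_; _*_; -_; 0#; 1#; +-cong; *-cong; -‿cong; +-assoc; +-identityʳ; +-identityˡ; -‿inverseˡ;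
          -‿inverseʳ) renaming (refl to ≈-refl; sym to ≈-sym; trans to ≈-trans; reflexive to ≈-reflexive)
  open Subfield Fq using (mem; mem-+; mem-neg)
  open LinearSums F
  open Transport F n size≡
  open FieldOnFin n isCommutativeRing 1≢0 element-inverse
  open Exp (CommutativeRing.commutativeSemiring K-ring) using (_^_)

  combination : (Fin r → Carrier) → Carrier
  combination a = sumF F (λ i → a i * α i)

  coordinate : Carrier → Fin r → Carrier
  coordinate x = proj₁ (proj₂ (proj₂ basis) x tt)

  coordinate∈Fq : ∀ x i → mem (coordinate x i)
  coordinate∈Fq x = proj₁ (proj₂ (proj₂ (proj₂ basis) x tt))

  combination-coordinate : ∀ x → combination (coordinate x) ≈ x
  combination-coordinate x = proj₂ (proj₂ (proj₂ (proj₂ basis) x tt))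

  combination-unique : ∀ {a b} → (∀ i → mem (a i)) → (∀ i → mem (b i)) → combination a ≈ combination b → ∀ i → a i ≈
      b i
  combination-unique {a} {b} a∈ b∈ eq i = ≈-trans (≈-sym (+-identityʳ (a i)))
      (≈-trans (+-cong ≈-refl (≈-sym (-‿inverseˡ (b i))))
    (≈-trans (≈-sym (+-assoc (a i) (- b i) (b i))) (≈-trans (+-cong (difference≈0 i) ≈-refl) (+-identityˡ (b i)))))
    where
    difference≈0 : ∀ i → a i + - b i ≈ 0#
    difference≈0 = proj₁ (proj₂ basis) (λ i → a i + - b i) (λ i → mem-+ (a∈ i) (mem-neg (b∈ i)))
      (≈-trans (sumF-+ a (λ i → - b i) α) (≈-trans (+-cong eq (sumF-neg b α)) (-‿inverseʳ (combination b))))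

  coordinate-affine : ∀ {x y z u} → u ≈ x + (- y + z) → ∀ i → coordinate u i ≈ coordinate x i +
      (- coordinate y i + coordinate z i)
  coordinate-affine {x} {y} {z} {u} u≈ = combination-unique (coordinate∈Fq u)
    (λ i → mem-+ (coordinate∈Fq x i) (mem-+ (mem-neg (coordinate∈Fq y i)) (coordinate∈Fq z i)))
    (≈-trans (combination-coordinate u) (≈-trans u≈ (≈-sym
      (≈-trans (sumF-+ (coordinate x) (λ i → - coordinate y i + coordinate z i) α)
        (+-cong (combination-coordinate x) (≈-trans (sumF-+ (λ i → - coordinate y i) (coordinate z) α)
          (+-cong (≈-trans (sumF-neg (coordinate y) α) (-‿cong (combination-coordinate y)))
              (combination-coordinate z))))))))

  -- Indices are compared instead of field elements because this makes the condition Boolean.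
  hyperplane : Fin r → K → Bool
  hyperplane i x = index (coordinate (element x) i) == index (c i)

  hyperplane⁻ : ∀ i x → hyperplane i x ≡ true → coordinate (element x) i ≈ c i
  hyperplane⁻ i x h = index-injective (does⁻ (index (coordinate (element x) i) Fin.≟ index (c i)) h)

  hyperplane⁺ : ∀ i x → coordinate (element x) i ≈ c i → hyperplane i x ≡ true
  hyperplane⁺ i x eq = does⁺ (index (coordinate (element x) i) Fin.≟ index (c i)) (index-cong eq)

  hyperplane-affine : ∀ i → IsAffine (hyperplane i)
  hyperplane-affine i = affine λ {x} {y} {z} hx hy hz → hyperplane⁺ i _
    (≈-trans (coordinate-affine
        (≈-trans (element-index _) (+-cong ≈-refl (≈-trans (element-index _) (+-cong (element-index _) ≈-refl)))) i)
      (≈-trans (+-cong (hyperplane⁻ i x hx) (+-cong (-‿cong (hyperplane⁻ i y hy)) (hyperplane⁻ i z hz)))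
        (≈-trans (+-cong ≈-refl (-‿inverseˡ (c i))) (+-identityʳ (c i)))))

  hyperplanes : List (K → Bool)
  hyperplanes = tabulate hyperplane

  avoids⇒InG : ∀ x → avoids hyperplanes x ≡ true → InG F mem α c (element x)
  avoids⇒InG x h = coordinate (element x) ,
    (λ i → coordinate∈Fq (element x) i , λ eq → contradiction
      (trans (sym (all-tabulate⁻ (λ V → not (V x)) hyperplane h i)) (cong not (hyperplane⁺ i x eq))) λ ()) ,
    ≈-sym (combination-coordinate (element x))

  -- A number below Q^r is decoded into r digits below Q, and `punchIn` turns each digit into one of
  -- the Q scalars other than c_i. Uniqueness of coordinates shows both that distinct numbers give
  -- distinct points and that these points miss every hyperplane.
  avoids-count : + (Q ℕ.^ r) ℤ.≤ sum (λ x → ⟦ avoids hyperplanes x ⟧)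
  avoids-count = injection⇒≤sum point point-injective (avoids hyperplanes) point-avoids
    where
    scalar = proj₁ Fq-card
    scalar∈ = proj₁ (proj₂ Fq-card)
    scalar-injective = proj₁ (proj₂ (proj₂ Fq-card))
    c-index : Fin r → Fin (suc Q)
    c-index i = proj₁ (proj₂ (proj₂ (proj₂ Fq-card)) (c i) (c∈Fq i))
    scalar-c-index : ∀ i → scalar (c-index i) ≈ c i
    scalar-c-index i = proj₂ (proj₂ (proj₂ (proj₂ Fq-card)) (c i) (c∈Fq i))
    coefficient : Fin (Q ℕ.^ r) → Fin r → Carrier
    coefficient j i = scalar (punchIn (c-index i) (finToFun j i))
    point : Fin (Q ℕ.^ r) → K
    point j = index (combination (coefficient j))
    point-injective : ∀ j k → point j ≡ point k → j ≡ k
    point-injective j k eq = trans (sym (Fin.funToFin-finToFin {r} {Q} j)) (trans (funToFin-cong {r} {Q} (λ i →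
      Fin.punchIn-injective (c-index i) _ _ (scalar-injective _ _
        (combination-unique (λ i → scalar∈ _) (λ i → scalar∈ _) (index-injective eq) i))))
            (Fin.funToFin-finToFin {r} {Q} k))
    point-avoids : ∀ j → avoids hyperplanes (point j) ≡ true
    point-avoids j = all-tabulate (λ V → not (V (point j))) hyperplane λ i → cong not (Bool.¬-not λ h →
      Fin.punchInᵢ≢i (c-index i) (finToFun j i) (scalar-injective _ _ (≈-trans
        (combination-unique (λ i → scalar∈ _) (coordinate∈Fq (element (point j)))
          (≈-sym (≈-trans (combination-coordinate (element (point j))) (element-index _))) i)
        (≈-trans (hyperplane⁻ i (point j) h) (≈-sym (scalar-c-index i))))))

  element-^ : ∀ x k → element (x ^ k) ≈ pow F (element x) k
  element-^ x zero = element-index 1#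
  element-^ x (suc k) = ≈-trans (element-index _) (*-cong ≈-refl (element-^ x k))

  survivor⇒Primitive : ∀ x → survivor x ≡ true → Primitive F (element x)
  survivor⇒Primitive x h = let x≢0 , generates = survivor-generates h in
    (λ eq → x≢0 (trans (sym (index-element x)) (index-cong eq))) ,
    λ y y≉0 → let k , xᵏ≡y = generates (index y) (λ eq → y≉0 (index-injective eq)) in
      k , ≈-trans (≈-sym (element-^ x k)) (≈-trans (≈-reflexive (cong element xᵏ≡y)) (element-index y))

  module _ {N : ℕ} (e : Fin N → Carrier)
    (e-complete : ∀ x → Primitive F x → InG F mem α c x → Σ (Fin N) λ i → e i ≈ x)
    (s : ℕ) (n≤s² : n ℕ.≤ s ℕ.* s) where

    survivors≤N : sum (λ x → ⟦ avoids hyperplanes x ∧ survivor x ⟧) ℤ.≤ + N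
    survivors≤N = surjection⇒sum≤ (index ∘ e) (λ x → avoids hyperplanes x ∧ survivor x) λ x h →
      let in-box , survives = ∧-true⁻ {avoids hyperplanes x} h
          i , eᵢ≈x = e-complete (element x) (survivor⇒Primitive x survives) (avoids⇒InG x in-box)
      in i , trans (index-cong eᵢ≈x) (index-element x)

    primitive-count : ∀ {Z} → let M = 2 ℕ.^ length (primeDivisors n) in
      Z ℕ.+ M ℕ.* M ℕ.* (2 ℕ.^ r ℕ.* s) ℕ.≤ Q ℕ.^ r ℕ.∸ 1 → φ n ℕ.* Z ℕ.≤ N ℕ.* n
    primitive-count = sieve-to-count {Π = product (primeDivisors n)} {Π′ = ∏∸1 (primeDivisors n)}
        {M = 2 ℕ.^ length (primeDivisors n)} {E = 2 ℕ.^ r ℕ.* s} {N = N} {n = n} {φn = φ n} {X = Q ℕ.^ r ℕ.∸ 1}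
      {{product-primeDivisors≢0 n}}
      (subst (λ l → ∏∸1 (primeDivisors n) ℕ.* (Q ℕ.^ r ℕ.∸ 1) ℕ.≤ product (primeDivisors n) ℕ.* N ℕ.+ product
          (primeDivisors n) ℕ.* (2 ℕ.^ length (primeDivisors n) ℕ.* (2 ℕ.^ l ℕ.* s)))
        (List.length-tabulate hyperplane)
        (avoids-sieve hyperplanes (All.tabulate⁺ hyperplane-affine) s n≤s² avoids-count survivors≤N))
      (φ-upper n) (product≤∏∸1*2^ω n)

primePower≥2 : ∀ {q} → IsPrimePower q → 2 ℕ.≤ q
primePower≥2 (zero , _ , p-prime , _) = contradiction p-prime ¬prime[0]
primePower≥2 (suc zero , _ , p-prime , _) = contradiction p-prime ¬prime[1]
primePower≥2 (suc (suc p) , suc k , _ , _ , refl) = ℕ.*-mono-≤ {2} {suc (suc p)} {1} (ℕ.s≤s (ℕ.s≤s ℕ.z≤n))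
    (ℕ.m^n>0 (suc (suc p)) k)

open import Data.Nat.Base using (_+_; _*_; _∸_; _^_; _≤_)

-- With r = 2 s, multiply the claim by q^r - 1 and move the subtracted term to the left. The eighth
-- power of (q-1)^(3r/4) is (q-1)^(12 s), and that of (q-1)^(1/4) accounts for the additional
-- exponent 2 on the right.
theorem3p5 : (q s : ℕ) → IsPrimePower q → 1 ≤ s →
    (K : FiniteField) → FiniteField.size K ≡ q ^ (s + s) →
    (Fq : Subfield K) → HasCard K (Subfield.mem Fq) q →
    (Fh : Subfield K) → HasCard K (Subfield.mem Fh) (q ^ s) →
    (∀ x → Subfield.mem Fq x → Subfield.mem Fh x) →
    (α : Fin (s + s) → FiniteField.Carrier K) →
    IsBasisOver K (Subfield.mem Fq) (λ _ → ⊤) α →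
    IsBasisOver K (Subfield.mem Fq) (Subfield.mem Fh) (λ (i : Fin s) → α (i ↑ˡ s)) →
    (c : Fin (s + s) → FiniteField.Carrier K) → (∀ i → Subfield.mem Fq (c i)) →
    (N : ℕ) → (e : Fin N → FiniteField.Carrier K) →
    (∀ i → Primitive K (e i) × InG K (Subfield.mem Fq) α c (e i)) →
    (∀ i j → FiniteField._≈_ K (e i) (e j) → i ≡ j) →
    (∀ x → Primitive K x → InG K (Subfield.mem Fq) α c x →
    Σ (Fin N) λ i → FiniteField._≈_ K (e i) x) →
    Root8Gt (N * (q ^ (s + s) ∸ 1))
    (2 ^ 8 * φ (q ^ (s + s) ∸ 1) ^ 8 * W (q ^ (s + s) ∸ 1) ^ 8 * (q ∸ 1) ^ (12 * s) * q)
    (φ (q ^ (s + s) ∸ 1) ^ 8 * (q ∸ 1) ^ (12 * s + 2))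
theorem3p5 zero _ q-primePower = contradiction (primePower≥2 q-primePower) λ ()
theorem3p5 (suc Q) zero _ ()
theorem3p5 q@(suc Q) s@(suc s-1) q-primePower _ K size≡ Fq Fq-card _ _ _ α basis _ c c∈Fq N e _ _ e-complete =
  root8-conclusion {φ n} {W n} {2 ^ length (primeDivisors n)} {Q} {s-1} {N} {n}
    (ℕ.≤-pred q≥2) (φ≥1 n 1≤n) (ℕ.m^n>0 2 (length (primeDivisors n))) (2^ω≤W n)
    -- The integer q^s bounds √n, because its square q^(s+s) equals n + 1.
    (Box.primitive-count K n size≡1+n Fq Fq-card α basis c c∈Fq e e-complete (q ^ s) n≤)
  where
  n = q ^ (s + s) ∸ 1
  q≥2 = primePower≥2 q-primePower
  size≡1+n : FiniteField.size K ≡ suc n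
  size≡1+n = trans size≡ (sym (ℕ.m+[n∸m]≡n (ℕ.m^n>0 q (s + s))))
  1≤n : 1 ≤ n
  1≤n = ℕ.∸-monoˡ-≤ 1 (ℕ.*-mono-≤ {2} {q} {1} q≥2 (ℕ.m^n>0 q (s-1 + s)))
  n≤ : n ≤ q ^ s * q ^ s
  n≤ = ℕ.≤-trans (ℕ.m∸n≤m (q ^ (s + s)) 1) (ℕ.≤-reflexive (ℕ.^-distribˡ-+-* q s s))
  instance
    n≢0 : ℕ.NonZero n
    n≢0 = ℕ.>-nonZero 1≤n
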